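{- Let $m,n\ge 3$ be integers such that $q=2mn+1$ is a prime power, there exist two distinct odd primes $p,p'$ with $p\mid m$ and $p'\mid n$, $m_o\cdot \mathrm{rad}(m_o)$ does not divide $n_o$, and $n_o\cdot\mathrm{rad}(n_o)$ does not divide $m_o$. Then there exists an optimal rank-one Heffter array H$(m,n)$ over $\mathbb{F}_q$, i.e. a rank-one H$(m,n)$ over $\mathbb{F}_q$ whose group of multipliers has order $\mathrm{lcm}(m_o,n_o)$.
   Context: For an integer $k$, $k_o$ denotes its odd part (largest odd divisor), and $\mathrm{rad}(k)$ is the product of the distinct primes dividing $k$ (with $\mathrm{rad}(1)=1$). A half-set of an additive group $G$ of odd order $2\ell+1$ is an $\ell$-subset $L$ with $L\cup -L=G\setminus\{0\}$. A Heffter array H$(m,n)$ over $\mathbb{F}_q$ is an $m\times n$ matrix over $\mathbb{F}_q$ whose entries form a half-set of the additive group of $\mathbb{F}_q$ and whose every row and column sums to $0$; it is rank-one if it has rank $1$ over $\mathbb{F}_q$. A multiplier of such an array $A$ is an element $u\in\mathbb{F}_q^*$ such that $uA$ or $uA^T$ can be obtained from $A$ by permuting its rows and columns; multipliers form a subgroup of $\mathbb{F}_q^*$. -}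

module Defs where

open import Level using (0ℓ)
open import Data.Nat as ℕ using (ℕ; zero; suc; _≤_; _%_)
open import Data.Nat.Divisibility using (_∣_; _∣?_)
open import Data.Nat.Primality using (Prime; prime?)
open import Data.Fin using (Fin)
open import Data.List using (List; filter; upTo; length)
open import Data.Nat.ListAction using (product)
open import Data.List.Membership.Propositional using (_∈_)
open import Data.List.Relation.Unary.Unique.Propositional using (Unique)
open import Data.Product using (Σ; ∃; ∃-syntax; _×_; _,_)
open import Data.Sum using (_⊎_)
open import Relation.Nullary using (¬_)
open import Relation.Nullary.Decidable using (_×-dec_)
open import Relation.Binary.PropositionalEquality using (_≡_; _≢_)
open import Algebra.Structures using (IsCommutativeRing)
open import Function.Bundles using (_↔_; Inverse)

Odd : ℕ → Set
Odd k = k % 2 ≡ 1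

IsOddPart : ℕ → ℕ → Set
IsOddPart k o = Odd o × o ∣ k × (∀ d → Odd d → d ∣ k → d ≤ o)

rad : ℕ → ℕ
rad k = product (filter (λ p → prime? p ×-dec p ∣? k) (upTo (suc k)))

IsPrimePower : ℕ → Set
IsPrimePower q = ∃[ p ] ∃[ e ] (Prime p × 1 ≤ e × q ≡ p ℕ.^ e)

-- A finite field with q elements, presented on the carrier Fin q
-- (every field of order q is isomorphic to one of this form).

record FiniteField (q : ℕ) : Set where
  infixl 7 _*_
  infixl 6 _+_
  infix  8 -_
  field
    _+_ _*_ : Fin q → Fin q → Fin q
    -_      : Fin q → Fin q
    0# 1#   : Fin q
    isCommutativeRing : IsCommutativeRing _≡_ _+_ _*_ -_ 0# 1#
    0≢1     : 0# ≢ 1#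
    inverse : ∀ x → x ≢ 0# → ∃[ y ] (x * y ≡ 1#)

module _ {q : ℕ} (F : FiniteField q) where
  open FiniteField F

  Matrix : ℕ → ℕ → Set
  Matrix m n = Fin m → Fin n → Fin q

  sumF : ∀ {k} → (Fin k → Fin q) → Fin q
  sumF {zero}  f = 0#
  sumF {suc k} f = f Fin.zero + sumF (λ i → f (Fin.suc i))
    where import Data.Fin as Fin

  IsHalfSetEntries : ∀ {m n} → Matrix m n → Set
  IsHalfSetEntries {m} {n} A =
      (∀ i j k l → A i j ≡ A k l → (i ≡ k × j ≡ l))
    × (∀ i j → A i j ≢ 0#)
    × (∀ x → x ≢ 0# → ∃[ i ] ∃[ j ] (A i j ≡ x ⊎ A i j ≡ - x))

  IsHeffter : ∀ {m n} → Matrix m n → Set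
  IsHeffter {m} {n} A =
      IsHalfSetEntries A
    × (∀ i → sumF (λ j → A i j) ≡ 0#)
    × (∀ j → sumF (λ i → A i j) ≡ 0#)

  IsRankOne : ∀ {m n} → Matrix m n → Set
  IsRankOne {m} {n} A =
      (Σ (Fin m → Fin q) λ u → Σ (Fin n → Fin q) λ v → ∀ i j → A i j ≡ u i * v j)
    × (∃[ i ] ∃[ j ] (A i j ≢ 0#))

  IsMultiplier : ∀ {m n} → Matrix m n → Fin q → Set
  IsMultiplier {m} {n} A u =
    u ≢ 0# ×
    (  (Σ (Fin m ↔ Fin m) λ σ → Σ (Fin n ↔ Fin n) λ τ →
          ∀ i j → u * A i j ≡ A (Inverse.to σ i) (Inverse.to τ j))
     ⊎ (Σ (Fin n ↔ Fin m) λ σ → Σ (Fin m ↔ Fin n) λ τ →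
          -- (u Aᵀ) j i = u * A i j equals A (σ j) (τ i)
          ∀ i j → u * A i j ≡ A (Inverse.to σ j) (Inverse.to τ i)))

  MultiplierGroupOrder : ∀ {m n} → Matrix m n → ℕ → Set
  MultiplierGroupOrder A k =
    ∃[ xs ] (Unique xs × (∀ u → u ∈ xs → IsMultiplier A u)
                       × (∀ u → IsMultiplier A u → u ∈ xs)
                       × length xs ≡ k)

{-# OPTIONS --safe #-}

-- With s and t coprime, s ∣ m, t ∣ n, let C_s and C_t be the subgroups of orders s and t of the
-- cyclic group F*, generated by g.  Put m = k s and n = l t; then U = ⋃_{c<k} g^c C_s and
-- V = ⋃_{d<l} g^(kd) C_t satisfy F* = ± U · V without repetition, because ± C_s C_t is the
-- subgroup of index k l.  If s, t > 1 then U and V sum to zero, so (u v)_{u∈U, v∈V} is a rank-one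
-- Heffter array, and every element of C_s C_t is a multiplier.  Conversely a multiplier is α β with
-- α U = U and β V = V; comparing products gives α^m = β^n = 1, and since −1 stabilises neither
-- U nor V the orders of α and β are odd, so (α β)^lcm(m_o, n_o) = 1.  The rad conditions allow
-- each odd prime power of lcm(m_o, n_o) to be given to s or to t with both staying nontrivial.
module Submission where

open import Defs
open import Level using (0ℓ)
open import Algebra.Bundles using (CommutativeRing)
open import Data.Nat using (ℕ; zero; suc; _<_; _≤_; z≤n; s≤s; z<s; NonZero; >-nonZero; _∸_; _%_)
import Data.Nat as ℕ
import Data.Nat.Properties as ℕ
open import Data.Nat.Coprimality using (Coprime; coprime-divisor; 1-coprimeTo)
import Data.Nat.Coprimality as Coprime
open import Data.Nat.Divisibility
  using (_∣_; divides; ∣-refl; ∣-trans; *-cancelˡ-∣; m%n≡0⇒n∣m; m∣m*n; n∣m*n; ∣⇒≤)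
open import Data.Nat.DivMod using (m≡m%n+[m/n]*n; m%n<n)
open import Data.Nat.Induction using (<-wellFounded)
open import Data.Nat.ListAction using (product)
open import Data.Nat.Tactic.RingSolver using (solve-∀)
open import Data.Fin.Base as Fin using (Fin; toℕ; fromℕ<; combine; remQuot)
open import Data.Fin.Properties as Fin
  using (toℕ-injective; toℕ<n; toℕ-fromℕ<; any?; pigeonhole; injective⇒≤;
         remQuot-combine; combine-remQuot; combine-injective; toℕ-combine)
open import Data.List.Base using (List; []; _∷_; allFin; filter; tabulate; upTo)
open import Data.List.Properties using (length-tabulate)
open import Data.List.Membership.Propositional using (_∈_)
open import Data.List.Membership.Propositional.Properties
  using (∈-allFin; ∈-filter⁺; ∈-tabulate⁺; ∈-tabulate⁻; ∈-upTo⁺)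
open import Data.List.Relation.Unary.All as All using (All; []; _∷_)
open import Data.List.Relation.Unary.All.Properties using (all-filter)
open import Data.List.Relation.Unary.AllPairs using ([]; _∷_)
open import Data.List.Relation.Unary.Any using (here; there)
open import Data.List.Relation.Unary.Unique.Propositional using (Unique)
import Data.List.Relation.Unary.Unique.Propositional.Properties as Unique
open import Data.Product using (Σ; ∃; ∃₂; ∃-syntax; _×_; _,_; proj₁; proj₂; uncurry)
open import Data.Sum using (_⊎_; inj₁; inj₂; [_,_]′)
open import Data.Vec.Base using (Vec; []; _∷_; replicate)
open import Function.Bundles using (_↔_; Inverse; mk↔ₛ′)
open import Function.Definitions using (Injective)
open import Induction.WellFounded using (Acc; acc)
open import Relation.Nullary using (¬_; yes; no; contradiction)
open import Relation.Nullary.Decidable using (_×-dec_)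
open import Relation.Binary.PropositionalEquality
  using (_≡_; _≢_; refl; sym; trans; cong; cong₂; subst; module ≡-Reasoning)

-- Divisibility, coprimality and valuations.

module NumberTheory where
  open import Data.Nat
  open import Data.Nat.Properties
  open import Data.Nat.Divisibility
  open import Data.Nat.Primality
  open import Data.Nat.Primality.Factorisation using (factorise; factorisationHasAllPrimeFactors)
  open import Data.Nat.LCM using (lcm; lcm-least; m∣lcm[m,n]; n∣lcm[m,n])

  divisor-positive : ∀ {d n} → d ∣ n → 0 < n → 0 < d
  divisor-positive {zero}  d∣n 0<n = contradiction (sym (0∣⇒≡0 d∣n)) (<⇒≢ 0<n)
  divisor-positive {suc _} _   _   = z<s

  factor-< : ∀ k {a} → 1 < k → 0 < a → a < k * a
  factor-< k {a} 1<k 0<a = subst (a <_) (*-comm a k) (m<m*n a k {{>-nonZero 0<a}} 1<k)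

  coprime-* : ∀ {a b c} → Coprime a c → Coprime b c → Coprime (a * b) c
  coprime-* coac cobc (d∣ab , d∣c) =
    cobc (coprime-divisor (λ (e∣d , e∣a) → coac (e∣a , ∣-trans e∣d d∣c)) d∣ab , d∣c)

  coprime-^ : ∀ {a c} e → Coprime a c → Coprime (a ^ e) c
  coprime-^ zero    _  = 1-coprimeTo _
  coprime-^ (suc e) co = coprime-* co (coprime-^ e co)

  coprime-∣ : ∀ {a b c d} → a ∣ c → b ∣ d → Coprime c d → Coprime a b
  coprime-∣ a∣c b∣d co (e∣a , e∣b) = co (∣-trans e∣a a∣c , ∣-trans e∣b b∣d)

  coprime-*∣ : ∀ {a b c} → Coprime a b → a ∣ c → b ∣ c → a * b ∣ c
  coprime-*∣ {a} {b} co a∣c (divides q refl) =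
    *-monoˡ-∣ b (coprime-divisor co (subst (a ∣_) (*-comm q b) a∣c))

  prime-coprime : ∀ {r a} → Prime r → ¬ r ∣ a → Coprime r a
  prime-coprime pr r∤a (d∣r , d∣a) with prime⇒irreducible pr d∣r
  ... | inj₁ d≡1  = d≡1
  ... | inj₂ refl = contradiction d∣a r∤a

  prime>1 : ∀ {r} → Prime r → 1 < r
  prime>1 pr = nonTrivial⇒n>1 _ {{prime⇒nonTrivial pr}}

  prime-divisor : ∀ {n} → 1 < n → ∃[ r ] (Prime r × r ∣ n)
  prime-divisor {n} 1<n with factorise n {{>-nonZero (<-trans z<s 1<n)}}
  ... | record { factors = [] ; isFactorisation = n≡1 } = contradiction (sym n≡1) (<⇒≢ 1<n)
  ... | record { factors = r ∷ rs ; isFactorisation = refl ; factorsPrime = pr ∷ _ } =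
    r , pr , m∣m*n (product rs)

  extract : ∀ {r} → 1 < r → ∀ n → 0 < n → ∃₂ λ α a → n ≡ r ^ α * a × ¬ r ∣ a
  extract {r} 1<r n = go n (<-wellFounded n)
    where
    go : ∀ n → Acc _<_ n → 0 < n → ∃₂ λ α a → n ≡ r ^ α * a × ¬ r ∣ a
    go n (acc rec) 0<n with r ∣? n
    ... | no r∤n = 0 , n , sym (+-identityʳ n) , r∤n
    ... | yes (divides k refl) =
      let 0<k = divisor-positive (m∣m*n r) 0<n
          α , a , k≡ , r∤a = go k (rec (subst (k <_) (*-comm r k) (factor-< r 1<r 0<k))) 0<k
      in suc α , a , trans (*-comm k r) (trans (cong (r *_) k≡) (sym (*-assoc r (r ^ α) a))) , r∤a

  exponent-≤ : ∀ {r a} → 0 < r → ¬ r ∣ a → ∀ e α → r ^ e ∣ r ^ α * a → e ≤ α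
  exponent-≤ 0<r r∤a zero    α       _ = z≤n
  exponent-≤ {r} {a} 0<r r∤a (suc e) zero h =
    contradiction (∣-trans (m∣m*n (r ^ e)) (subst (r * r ^ e ∣_) (*-identityˡ a) h)) r∤a
  exponent-≤ {r} {a} 0<r r∤a (suc e) (suc α) h =
    s≤s (exponent-≤ 0<r r∤a e α (*-cancelˡ-∣ r {{>-nonZero 0<r}}
          (subst (r * r ^ e ∣_) (*-assoc r (r ^ α) a) h)))

  ^-monoʳ-∣ : ∀ r {e f} → e ≤ f → r ^ e ∣ r ^ f
  ^-monoʳ-∣ r {e} {f} e≤f =
    subst (r ^ e ∣_) (trans (sym (^-distribˡ-+-* r e (f ∸ e))) (cong (r ^_) (m+[n∸m]≡n e≤f)))
          (m∣m*n (r ^ (f ∸ e)))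

  -- Strong induction: a number other than 1 has a prime divisor `r`, and removing the full power of
  -- `r` leaves a smaller cofactor.
  prime-power-induction : (P : ℕ → Set) → P 1 →
    (∀ r α a → Prime r → ¬ r ∣ a → P a → P (r ^ α * a)) → ∀ n → 0 < n → P n
  prime-power-induction P P1 Pstep n = go n (<-wellFounded n)
    where
    go : ∀ n → Acc _<_ n → 0 < n → P n
    go n (acc rec) 0<n with n ≟ 1
    ... | yes refl = P1
    ... | no n≢1 with prime-divisor (≤∧≢⇒< 0<n (λ e → n≢1 (sym e)))
    ...   | r , pr , r∣n with extract (prime>1 pr) n 0<n
    ...     | zero , a , refl , r∤a =
      contradiction (subst (r ∣_) (*-identityˡ a) r∣n) r∤a
    ...     | suc α , a , refl , r∤a =
      Pstep r (suc α) a pr r∤a (go a (rec (factor-< (r ^ suc α) 1<r^ 0<a)) 0<a)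
      where
      0<a = divisor-positive (n∣m*n (r ^ suc α)) 0<n
      1<r^ : 1 < r ^ suc α
      1<r^ = ≤-trans (prime>1 pr)
                     (m≤m*n r (r ^ α) {{m^n≢0 r α {{prime⇒nonZero pr}}}})

  -- Dominates r n m says that the r-adic valuation of m is at most that of n.
  Dominates : ℕ → ℕ → ℕ → Set
  Dominates r n m = ∀ e → r ^ e ∣ m → r ^ e ∣ n

  dominates-from-≤ : ∀ {r m n α β a b} → 0 < r → m ≡ r ^ α * a → ¬ r ∣ a → n ≡ r ^ β * b →
    α ≤ β → Dominates r n m
  dominates-from-≤ {r} {α = α} {b = b} 0<r refl r∤a refl α≤β e h =
    ∣m⇒∣m*n b (^-monoʳ-∣ r (≤-trans (exponent-≤ 0<r r∤a e α h) α≤β))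

  dominates-total : ∀ {r m n} → 1 < r → 0 < m → 0 < n → Dominates r n m ⊎ Dominates r m n
  dominates-total {r} {m} {n} 1<r 0<m 0<n with extract 1<r m 0<m | extract 1<r n 0<n
  ... | α , a , m≡ , r∤a | β , b , n≡ , r∤b with ≤-total α β
  ...   | inj₁ α≤β = inj₁ (dominates-from-≤ (<-trans z<s 1<r) m≡ r∤a n≡ α≤β)
  ...   | inj₂ β≤α = inj₂ (dominates-from-≤ (<-trans z<s 1<r) n≡ r∤b m≡ β≤α)

  -- Local-global principle: the prime powers exactly dividing `m` are pairwise coprime, so their
  -- product divides `n` once each of them does.
  ∣-by-prime-powers : ∀ {n} m → 0 < m → (∀ r → Prime r → Dominates r n m) → m ∣ n
  ∣-by-prime-powers {n} = prime-power-induction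
    (λ m → (∀ r → Prime r → Dominates r n m) → m ∣ n)
    (λ _ → 1∣ n)
    (λ r α a pr r∤a IH dom → coprime-*∣ (coprime-^ α (prime-coprime pr r∤a))
      (dom r pr α (m∣m*n a))
      (IH (λ r′ pr′ e h → dom r′ pr′ e (∣n⇒∣m*n (r ^ α) h))))

  -- The prime supplied by a radical condition.

  module _ (m n : ℕ) (0<m : 0 < m) (0<n : 0 < n) where

    private
      -- The `r`-adic valuation of `m` is strictly below that of `n`; the exact exponent `α` is kept
      -- as a witness. `Upper` is the opposite case for a prime divisor of `m`.
      Lower : ℕ → Set
      Lower r = ∃₂ λ α a → m ≡ r ^ α * a × ¬ r ∣ a × r ^ suc α ∣ n

      Upper : ℕ → Set
      Upper r = Prime r × r ∣ m × Dominates r m n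

      lower-or-upper : ∀ {r} → Prime r × r ∣ m → Lower r ⊎ Upper r
      lower-or-upper {r} (pr , r∣m) with extract (prime>1 pr) m 0<m | extract (prime>1 pr) n 0<n
      ... | α , a , m≡ , r∤a | β , b , n≡ , r∤b with α <? β
      ...   | yes α<β = inj₁ (α , a , m≡ , r∤a ,
                              subst (r ^ suc α ∣_) (sym n≡) (∣m⇒∣m*n b (^-monoʳ-∣ r α<β)))
      ...   | no α≮β = inj₂ (pr , r∣m ,
                             dominates-from-≤ (<-trans z<s (prime>1 pr)) n≡ r∤b m≡ (≮⇒≥ α≮β))

      -- Each prime in `ps` occurs at least once more in `n` than in `m`. With `m` written as
      -- `r ^ α * a`, both `r ^ suc α` and `a * product ps` divide `n`, and they are coprime because
      -- `r` divides neither `a` nor, by uniqueness, the product of the other primes.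
      *product∣ : m ∣ n → ∀ ps → Unique ps → All Prime ps → All Lower ps → m * product ps ∣ n
      *product∣ m∣n [] _ _ _ = subst (_∣ n) (sym (*-identityʳ m)) m∣n
      *product∣ m∣n (r ∷ ps) (r∉ps ∷ uniq) (pr ∷ prs) ((α , a , refl , r∤a , low) ∷ lows) =
        subst (_∣ n) (eq r (r ^ α) a (product ps))
          (coprime-*∣ (coprime-^ (suc α) (prime-coprime pr r∤rest)) low
            (m*n∣⇒n∣ (r ^ α) (a * product ps)
              (subst (_∣ n) (*-assoc (r ^ α) a (product ps)) (*product∣ m∣n ps uniq prs lows))))
        where
        eq : ∀ r x a p → r * x * (a * p) ≡ x * a * (r * p)
        eq = solve-∀
        r∤rest : ¬ r ∣ a * product ps
        r∤rest h with euclidsLemma a (product ps) pr h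
        ... | inj₁ r∣a = r∤a r∣a
        ... | inj₂ r∣ps = All.lookup r∉ps (factorisationHasAllPrimeFactors pr r∣ps prs) refl

      primes : List ℕ
      primes = filter (λ p → prime? p ×-dec p ∣? m) (upTo (suc m))

      primes-sound : All (λ r → Prime r × r ∣ m) primes
      primes-sound = all-filter (λ p → prime? p ×-dec p ∣? m) (upTo (suc m))

      all-lower⇒∣ : All Lower primes → m ∣ n
      all-lower⇒∣ lows = ∣-by-prime-powers m 0<m dom
        where
        dom : ∀ r → Prime r → Dominates r n m
        dom r pr zero    _ = 1∣ n
        dom r pr (suc e) h with r∣m ← ∣-trans (m∣m*n (r ^ e)) h
          with All.lookup lows (∈-filter⁺ (λ p → prime? p ×-dec p ∣? m)
                 (∈-upTo⁺ (s≤s (∣⇒≤ {{>-nonZero 0<m}} r∣m))) (pr , r∣m))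
        ... | α , a , m≡ , r∤a , low =
          ∣-trans (^-monoʳ-∣ r (m≤n⇒m≤1+n (exponent-≤ (<-trans z<s (prime>1 pr)) r∤a (suc e) α
                    (subst (r ^ suc e ∣_) m≡ h)))) low

    -- Otherwise every prime divisor of `m` has a smaller valuation in `m` than in `n`, which leaves
    -- room in `n` for one more factor of each, that is, for `m * rad m`.
    dominating-prime : ¬ (m * rad m ∣ n) → ∃[ r ] (Prime r × r ∣ m × Dominates r m n)
    dominating-prime ∤n with search primes primes-sound
      where
      search : ∀ ps → All (λ r → Prime r × r ∣ m) ps → All Lower ps ⊎ ∃ Upper
      search [] [] = inj₁ []
      search (p ∷ ps) (h ∷ hs) with lower-or-upper h | search ps hs
      ... | inj₂ up | _        = inj₂ (p , up)
      ... | inj₁ _  | inj₂ up  = inj₂ up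
      ... | inj₁ lo | inj₁ los = inj₁ (lo ∷ los)
    ... | inj₂ found = found
    ... | inj₁ lows = contradiction
      -- `product primes` unfolds to `rad m`.
      (*product∣ (all-lower⇒∣ lows) primes
        (Unique.filter⁺ (λ p → prime? p ×-dec p ∣? m) (Unique.upTo⁺ (suc m)))
        (All.map proj₁ primes-sound) lows) ∤n

  -- Coprime splits of the least common multiple.

  record CoprimeSplit (m n s t : ℕ) : Set where
    field
      s∣m     : s ∣ m
      t∣n     : t ∣ n
      coprime : Coprime s t
      m∣s*t   : m ∣ s * t
      n∣s*t   : n ∣ s * t

  split-swap : ∀ {m n s t} → CoprimeSplit m n s t → CoprimeSplit n m t s
  split-swap {m} {n} {s} {t} sp = record
    { s∣m = t∣n ; t∣n = s∣m ; coprime = Coprime.sym coprime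
    ; m∣s*t = subst (n ∣_) (*-comm s t) n∣s*t ; n∣s*t = subst (m ∣_) (*-comm s t) m∣s*t }
    where open CoprimeSplit sp

  -- A prime power goes to the side where its exponent is not smaller. It stays coprime to `t`
  -- because `r` does not divide `n`, hence does not divide `t`.
  split-primeˡ : ∀ {r m n s t} α β → Prime r → ¬ r ∣ n → β ≤ α → CoprimeSplit m n s t →
    CoprimeSplit (r ^ α * m) (r ^ β * n) (r ^ α * s) t
  split-primeˡ {r} {m} {n} {s} {t} α β pr r∤n β≤α sp = record
    { s∣m = *-monoʳ-∣ (r ^ α) s∣m
    ; t∣n = ∣n⇒∣m*n (r ^ β) t∣n
    ; coprime = coprime-* (coprime-^ α (prime-coprime pr (λ r∣t → r∤n (∣-trans r∣t t∣n)))) coprime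
    ; m∣s*t = assoc (*-monoʳ-∣ (r ^ α) m∣s*t)
    ; n∣s*t = assoc (*-pres-∣ (^-monoʳ-∣ r β≤α) n∣s*t) }
    where
    open CoprimeSplit sp
    assoc : ∀ {x} → x ∣ r ^ α * (s * t) → x ∣ r ^ α * s * t
    assoc {x} = subst (x ∣_) (sym (*-assoc (r ^ α) s t))

  split-primeʳ : ∀ {r m n s t} α β → Prime r → ¬ r ∣ m → α ≤ β → CoprimeSplit m n s t →
    CoprimeSplit (r ^ α * m) (r ^ β * n) s (r ^ β * t)
  split-primeʳ α β pr r∤m α≤β sp = split-swap (split-primeˡ β α pr r∤m α≤β (split-swap sp))

  -- Each prime in turn gives its larger power to the side that power comes from. The base case
  -- `m = 1` takes `s = 1` and `t = n`.
  coprime-split : ∀ m n → 0 < m → 0 < n → ∃₂ λ s t → CoprimeSplit m n s t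
  coprime-split m n 0<m = prime-power-induction
    (λ m → ∀ n → 0 < n → ∃₂ λ s t → CoprimeSplit m n s t)
    (λ n _ → 1 , n , record { s∣m = ∣-refl ; t∣n = ∣-refl ; coprime = 1-coprimeTo n
                            ; m∣s*t = 1∣ _ ; n∣s*t = n∣m*n 1 })
    step m 0<m n
    where
    step : ∀ r α a → Prime r → ¬ r ∣ a → (∀ n → 0 < n → ∃₂ λ s t → CoprimeSplit a n s t) →
      ∀ n → 0 < n → ∃₂ λ s t → CoprimeSplit (r ^ α * a) n s t
    step r α a pr r∤a IH n 0<n with extract (prime>1 pr) n 0<n
    ... | β , b , refl , r∤b with IH b (divisor-positive (n∣m*n (r ^ β)) 0<n) | ≤-total β α
    ...   | s , t , sp | inj₁ β≤α = _ , _ , split-primeˡ α β pr r∤b β≤α sp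
    ...   | s , t , sp | inj₂ α≤β = _ , _ , split-primeʳ α β pr r∤a α≤β sp

  exponent≥1 : ∀ {r a} α → ¬ r ∣ a → r ∣ r ^ α * a → 1 ≤ α
  exponent≥1 {r} {a} zero r∤a h = contradiction (subst (r ∣_) (*-identityˡ a) h) r∤a
  exponent≥1 (suc α) _ _ = s≤s z≤n

  -- Both primes are stripped from `m` and `n`, the rest is split arbitrarily, and then the power of
  -- `r` goes to `s` and that of `r′` to `t`, as the two dominance hypotheses permit.
  coprime-split-at : ∀ {m n r r′} → 0 < m → 0 < n → Prime r → Prime r′ → r ≢ r′ →
    r ∣ m → Dominates r m n → r′ ∣ n → Dominates r′ n m →
    ∃₂ λ s t → CoprimeSplit m n s t × r ∣ s × r′ ∣ t
  coprime-split-at {m} {n} {r} {r′} 0<m 0<n pr pr′ r≢r′ r∣m dom r′∣n dom′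
    with extract (prime>1 pr) m 0<m | extract (prime>1 pr) n 0<n
  ... | α , m₁ , refl , r∤m₁ | β , n₁ , refl , r∤n₁
    with 0<m₁ ← divisor-positive (n∣m*n (r ^ α) {m₁}) 0<m
       | 0<n₁ ← divisor-positive (n∣m*n (r ^ β) {n₁}) 0<n
    with extract (prime>1 pr′) m₁ 0<m₁ | extract (prime>1 pr′) n₁ 0<n₁
  ... | γ , m₂ , refl , r′∤m₂ | δ , n₂ , refl , r′∤n₂
    with coprime-split m₂ n₂ (divisor-positive (n∣m*n (r′ ^ γ)) 0<m₁) (divisor-positive (n∣m*n (r′ ^ δ)) 0<n₁)
  ... | s , t , sp =
    r ^ α * s , r′ ^ δ * t ,
    split-primeˡ α β pr r∤n₁ β≤α (split-primeʳ γ δ pr′ r′∤m₂ γ≤δ sp) ,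
    ∣m⇒∣m*n s (subst (_∣ r ^ α) (*-identityʳ r) (^-monoʳ-∣ r (exponent≥1 α r∤m₁ r∣m))) ,
    ∣m⇒∣m*n t (subst (_∣ r′ ^ δ) (*-identityʳ r′) (^-monoʳ-∣ r′ (exponent≥1 δ r′∤n₂ r′∣n₁)))
    where
    r′∤r : ¬ r′ ∣ r
    r′∤r h with prime⇒irreducible pr h
    ... | inj₁ refl = ¬prime[1] pr′
    ... | inj₂ refl = r≢r′ refl
    powers-coprime : ∀ e f → Coprime (r′ ^ e) (r ^ f)
    powers-coprime e f = coprime-^ e (Coprime.sym (coprime-^ f (Coprime.sym (prime-coprime pr′ r′∤r))))
    r′∣n₁ : r′ ∣ n₁
    r′∣n₁ = coprime-divisor (Coprime.sym (coprime-^ β (Coprime.sym (prime-coprime pr′ r′∤r)))) r′∣n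
    β≤α : β ≤ α
    β≤α = exponent-≤ (<-trans z<s (prime>1 pr)) r∤m₁ β α (dom β (m∣m*n n₁))
    -- Dominance of `r′` survives the removal of the powers of `r`, because these are coprime to the
    -- powers of `r′`.
    γ≤δ : γ ≤ δ
    γ≤δ = exponent-≤ (<-trans z<s (prime>1 pr′)) r′∤n₂ γ δ
      (coprime-divisor (powers-coprime γ β) (dom′ γ (∣n⇒∣m*n (r ^ α) (m∣m*n m₂))))

  NontrivialCoprimeSplit : ℕ → ℕ → Set
  NontrivialCoprimeSplit m n = ∃₂ λ s t → CoprimeSplit m n s t × 1 < s × 1 < t

  nontrivial-split-at : ∀ {m n r r′} → 0 < m → 0 < n → Prime r → Prime r′ → r ≢ r′ →
    r ∣ m → Dominates r m n → r′ ∣ n → Dominates r′ n m → NontrivialCoprimeSplit m n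
  nontrivial-split-at 0<m 0<n pr pr′ r≢r′ r∣m dom r′∣n dom′
    with s , t , sp , r∣s , r′∣t ← coprime-split-at 0<m 0<n pr pr′ r≢r′ r∣m dom r′∣n dom′ =
    s , t , sp ,
    ≤-trans (prime>1 pr) (∣⇒≤ {{>-nonZero (divisor-positive (CoprimeSplit.s∣m sp) 0<m)}} r∣s) ,
    ≤-trans (prime>1 pr′) (∣⇒≤ {{>-nonZero (divisor-positive (CoprimeSplit.t∣n sp) 0<n)}} r′∣t)

  -- If the two rad conditions single out the same prime r, any other prime of m or n can
  -- replace it on one of the two sides.
  nontrivial-split-exchange : ∀ {m n r ρ} → 0 < m → 0 < n → Prime r → Prime ρ → ρ ≢ r →
    r ∣ m → Dominates r m n → r ∣ n → Dominates r n m → ρ ∣ m ⊎ ρ ∣ n →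
    NontrivialCoprimeSplit m n
  nontrivial-split-exchange {m} {n} {r} {ρ} 0<m 0<n pr pρ ρ≢r r∣m dom r∣n dom′ ρ∣
    with dominates-total {ρ} {n} {m} (prime>1 pρ) 0<n 0<m
  ... | inj₁ domρ = nontrivial-split-at 0<m 0<n pρ pr ρ≢r
    ([ (λ h → h) , lift domρ ]′ ρ∣) domρ r∣n dom′
    where
    lift : Dominates ρ m n → ρ ∣ n → ρ ∣ m
    lift dom = subst (λ x → x ∣ n → x ∣ m) (*-identityʳ ρ) (dom 1)
  ... | inj₂ domρ = nontrivial-split-at 0<m 0<n pr pρ (λ e → ρ≢r (sym e))
    r∣m dom ([ lift domρ , (λ h → h) ]′ ρ∣) domρ
    where
    lift : Dominates ρ n m → ρ ∣ m → ρ ∣ n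
    lift dom = subst (λ x → x ∣ m → x ∣ n) (*-identityʳ ρ) (dom 1)

  -- The two conditions supply a prime for each side. If these primes coincide, one of `p`, `p′`
  -- differs from the common prime and allows an exchange.
  nontrivial-coprime-split : ∀ {m n p p′} → 0 < m → 0 < n → Prime p → Prime p′ → p ≢ p′ →
    p ∣ m → p′ ∣ n → ¬ (m * rad m ∣ n) → ¬ (n * rad n ∣ m) →
    NontrivialCoprimeSplit m n
  nontrivial-coprime-split {m} {n} {p} {p′} 0<m 0<n pp pp′ p≢p′ p∣m p′∣n ∤n ∤m
    with dominating-prime m n 0<m 0<n ∤n | dominating-prime n m 0<n 0<m ∤m
  ... | r , pr , r∣m , dom | r′ , pr′ , r′∣n , dom′ with r ≟ r′
  ...   | no r≢r′ = nontrivial-split-at 0<m 0<n pr pr′ r≢r′ r∣m dom r′∣n dom′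
  ...   | yes refl with p ≟ r
  ...     | no p≢r = nontrivial-split-exchange 0<m 0<n pr pp p≢r r∣m dom r′∣n dom′ (inj₁ p∣m)
  ...     | yes refl = nontrivial-split-exchange 0<m 0<n pr pp′ (λ e → p≢p′ (sym e)) r∣m dom r′∣n dom′ (inj₂ p′∣n)

  -- Oddness, odd parts and the least common multiple.

  odd⇒coprime-2 : ∀ {k} → Odd k → Coprime k 2
  odd⇒coprime-2 {k} odd = Coprime.sym (prime-coprime prime[2]
    (λ 2∣k → contradiction (trans (sym odd) (n∣m⇒m%n≡0 k 2 2∣k)) λ ()))

  2∤⇒odd : ∀ {k} → ¬ 2 ∣ k → Odd k
  2∤⇒odd {k} 2∤k with k % 2 in eq | m%n<n k 2
  ... | 0           | _               = contradiction (m%n≡0⇒n∣m k 2 eq) 2∤k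
  ... | 1           | _               = refl
  ... | suc (suc _) | s≤s (s≤s ())

  odd-* : ∀ {j k} → Odd j → Odd k → Odd (j * k)
  odd-* {j} {k} oj ok = 2∤⇒odd λ 2∣jk →
    contradiction (coprime-* (odd⇒coprime-2 {j} oj) (odd⇒coprime-2 {k} ok) (2∣jk , ∣-refl)) λ ()

  -- If the cofactor is `2 ^ e * a` with `a` odd, then `o * a` is an odd divisor of `m`, and
  -- maximality of `o` forces `a = 1`.
  odd-part-cofactor : ∀ {m o} → 0 < m → IsOddPart m o → ∃[ e ] m ≡ o * 2 ^ e
  odd-part-cofactor {m} {o} 0<m (odd , divides c refl , maximal)
    with extract {2} (s≤s (s≤s z≤n)) c (divisor-positive (m∣m*n o) 0<m)
  ... | e , a , refl , 2∤a = e , trans (*-comm _ o) (cong (o *_) (trans (cong (2 ^ e *_) a≡1) (*-identityʳ _)))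
    where
    0<o : 0 < o
    0<o = divisor-positive (n∣m*n (2 ^ e * a)) 0<m
    0<a : 0 < a
    0<a = divisor-positive (∣m⇒∣m*n o (n∣m*n (2 ^ e))) 0<m
    oa≤o : o * a ≤ o
    oa≤o = maximal (o * a) (odd-* {o} odd (2∤⇒odd 2∤a))
      (subst (o * a ∣_) (*-comm o _) (*-monoʳ-∣ o (n∣m*n (2 ^ e))))
    a≡1 : a ≡ 1
    a≡1 = ≤-antisym (*-cancelˡ-≤ o {{>-nonZero 0<o}} (subst (o * a ≤_) (sym (*-identityʳ o)) oa≤o)) 0<a

  odd-divisor : ∀ {p o} e → Odd p → p ∣ o * 2 ^ e → p ∣ o
  odd-divisor {p} {o} e odd p∣ = coprime-divisor
    (Coprime.sym (coprime-^ e (Coprime.sym (odd⇒coprime-2 odd)))) (subst (p ∣_) (*-comm o (2 ^ e)) p∣)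

  split-lcm : ∀ {m n s t} → CoprimeSplit m n s t → s * t ≡ lcm m n
  split-lcm {m} {n} sp = ∣-antisym
    (coprime-*∣ coprime (∣-trans s∣m (m∣lcm[m,n] m n)) (∣-trans t∣n (n∣lcm[m,n] m n)))
    (lcm-least m∣s*t n∣s*t)
    where open CoprimeSplit sp

open NumberTheory

remQuot-injective : ∀ n k {i j : Fin (n ℕ.* k)} → remQuot {n} k i ≡ remQuot {n} k j → i ≡ j
remQuot-injective n k {i} {j} e =
  trans (sym (combine-remQuot {n} k i)) (trans (cong (uncurry combine) e) (combine-remQuot {n} k j))

-- Arithmetic in a finite field.

module RankOneHeffter {q : ℕ} (F : FiniteField q) where
  open FiniteField F

  commutativeRing : CommutativeRing 0ℓ 0ℓ
  commutativeRing = record { isCommutativeRing = isCommutativeRing }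

  open CommutativeRing commutativeRing
    using (commutativeSemiring; semiring; *-commutativeMonoid; *-commutativeSemigroup;
           +-commutativeMonoid; +-group; *-assoc; *-comm; *-identityˡ; *-identityʳ; +-identityˡ; +-identityʳ; zeroˡ; zeroʳ;
           -‿inverseˡ; +-assoc; +-comm)
  open import Algebra.Properties.CommutativeSemiring.Exp commutativeSemiring
  open import Algebra.Properties.Group +-group using (x∙y⁻¹≈ε⇒x≈y; inverseˡ-unique; identityʳ-unique)
  open import Algebra.Properties.CommutativeMonoid.Sum +-commutativeMonoid
    using (sum; sum-permute; sum-cong-≗)
  open import Algebra.Properties.CommutativeMonoid.Sum *-commutativeMonoid
    renaming (sum to ∏; sum-permute to ∏-permute; sum-cong-≗ to ∏-cong)
    using ()
  open import Algebra.Properties.Semiring.Sum semiring using (*-distribˡ-sum; *-distribʳ-sum)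
  open import Algebra.Properties.CommutativeSemigroup *-commutativeSemigroup using (interchange; x∙yz≈y∙xz)
  open import Algebra.Solver.Ring.NaturalCoefficients.Default commutativeSemiring
    using (solve; _:=_; _:+_; _:*_; con)
  open ≡-Reasoning

  *-cancelˡ : ∀ {x y z} → x ≢ 0# → x * y ≡ x * z → y ≡ z
  *-cancelˡ {x} {y} {z} x≢0 e with x′ , xx′≡1 ← inverse x x≢0 = begin
    y            ≡⟨ undo y ⟨
    x′ * (x * y) ≡⟨ cong (x′ *_) e ⟩
    x′ * (x * z) ≡⟨ undo z ⟩
    z            ∎
    where
    undo : ∀ w → x′ * (x * w) ≡ w
    undo w = trans (sym (*-assoc x′ x w))
      (trans (cong (_* w) (trans (*-comm x′ x) xx′≡1)) (*-identityˡ w))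

  *-cancelʳ : ∀ {x y z} → x ≢ 0# → y * x ≡ z * x → y ≡ z
  *-cancelʳ {x} {y} {z} x≢0 e = *-cancelˡ x≢0 (trans (*-comm x y) (trans e (*-comm z x)))

  no-zero-divisors : ∀ {x y} → x ≢ 0# → x * y ≡ 0# → y ≡ 0#
  no-zero-divisors {x} x≢0 e = *-cancelˡ x≢0 (trans e (sym (zeroʳ x)))

  *-≢0 : ∀ {x y} → x ≢ 0# → y ≢ 0# → x * y ≢ 0#
  *-≢0 x≢0 y≢0 e = y≢0 (no-zero-divisors x≢0 e)

  ^-≢0 : ∀ {x} e → x ≢ 0# → x ^ e ≢ 0#
  ^-≢0 zero    _   1≡0 = 0≢1 (sym 1≡0)
  ^-≢0 (suc e) x≢0     = *-≢0 x≢0 (^-≢0 e x≢0)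

  1^ : ∀ e → 1# ^ e ≡ 1#
  1^ zero    = refl
  1^ (suc e) = trans (*-identityˡ _) (1^ e)

  0^ : ∀ {e} → 0 < e → 0# ^ e ≡ 0#
  0^ {suc e} _ = zeroˡ _

  unit-≢0 : ∀ {x e} → 0 < e → x ^ e ≡ 1# → x ≢ 0#
  unit-≢0 0<e x^e≡1 refl = 0≢1 (trans (sym (0^ 0<e)) x^e≡1)

  ^-multiple : ∀ {x a b} → x ^ a ≡ 1# → a ∣ b → x ^ b ≡ 1#
  ^-multiple {x} {a} x^a≡1 (divides k refl) = begin
    x ^ (k ℕ.* a) ≡⟨ cong (x ^_) (ℕ.*-comm k a) ⟩
    x ^ (a ℕ.* k) ≡⟨ ^-assocʳ x a k ⟨
    (x ^ a) ^ k   ≡⟨ cong (_^ k) x^a≡1 ⟩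
    1# ^ k        ≡⟨ 1^ k ⟩
    1#            ∎

  ^-% : ∀ {x s} .{{_ : NonZero s}} → x ^ s ≡ 1# → ∀ e → x ^ e ≡ x ^ (e % s)
  ^-% {x} {s} x^s≡1 e = begin
    x ^ e                                  ≡⟨ cong (x ^_) (m≡m%n+[m/n]*n e s) ⟩
    x ^ (e % s ℕ.+ (e ℕ./ s) ℕ.* s)        ≡⟨ ^-homo-* x (e % s) _ ⟩
    x ^ (e % s) * x ^ ((e ℕ./ s) ℕ.* s)    ≡⟨ cong (x ^ (e % s) *_) (^-multiple x^s≡1 (n∣m*n (e ℕ./ s))) ⟩
    x ^ (e % s) * 1#                       ≡⟨ *-identityʳ _ ⟩
    x ^ (e % s)                            ∎

  ^-swap : ∀ x a b → (x ^ a) ^ b ≡ (x ^ b) ^ a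
  ^-swap x a b = trans (^-assocʳ x a b) (trans (cong (x ^_) (ℕ.*-comm a b)) (sym (^-assocʳ x b a)))

  -- Lets the semiring solver, which knows no negation, treat a difference as an atom: `x` is
  -- replaced by `r + d` with `d = x + - r`.
  restore : ∀ x r → x ≡ r + (x + - r)
  restore x r = begin
    x               ≡⟨ +-identityʳ x ⟨
    x + 0#          ≡⟨ cong (x +_) (-‿inverseˡ r) ⟨
    x + (- r + r)   ≡⟨ +-assoc x (- r) r ⟨
    (x + - r) + r   ≡⟨ +-comm _ r ⟩
    r + (x + - r)   ∎

  -- With `d = x + - y`, the square of `x = y + d` is `y * y + d * (x + y)`, so `d * (x + y)`
  -- vanishes and one factor is zero.
  squares-equal : ∀ {x y} → x ^ 2 ≡ y ^ 2 → x ≡ y ⊎ x ≡ - y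
  squares-equal {x} {y} e with x Fin.≟ y
  ... | yes x≡y = inj₁ x≡y
  ... | no x≢y = inj₂ (inverseˡ-unique x y
    (no-zero-divisors (λ e → x≢y (x∙y⁻¹≈ε⇒x≈y x y e)) (identityʳ-unique (y * y) _ (begin
      y * y + d * (x + y)           ≡⟨ cong (λ z → y * y + d * (z + y)) x≡ ⟩
      y * y + d * ((y + d) + y)     ≡⟨ solve 2 (λ y d →
                                         y :* y :+ d :* ((y :+ d) :+ y) := (y :+ d) :* (y :+ d)) refl y d ⟩
      (y + d) * (y + d)             ≡⟨ cong₂ _*_ x≡ x≡ ⟨
      x * x                         ≡⟨ sq x ⟨
      x ^ 2                         ≡⟨ e ⟩
      y ^ 2                         ≡⟨ sq y ⟩
      y * y                         ∎))))
    where
    sq : ∀ x → x ^ 2 ≡ x * x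
    sq x = cong (x *_) (*-identityʳ x)
    d = x + - y
    x≡ = restore x y

  -- Roots of monic polynomials.

  -- A vector of length k lists the lower coefficients of a monic polynomial of degree k.
  evalMonic : ∀ {k} → Vec (Fin q) k → Fin q → Fin q
  evalMonic []       x = 1#
  evalMonic (a ∷ as) x = a + x * evalMonic as x

  -- Horner's scheme: the coefficients of the quotient of f(x) - f(r) by x - r are the intermediate
  -- values in the evaluation of f at `r`.
  quotientMonic : ∀ {k} → Vec (Fin q) (suc k) → Fin q → Vec (Fin q) k
  quotientMonic (a ∷ [])     r = []
  quotientMonic (a ∷ b ∷ as) r = evalMonic (b ∷ as) r ∷ quotientMonic (b ∷ as) r

  synthetic-division : ∀ {k} (as : Vec (Fin q) (suc k)) r d →
    evalMonic as (r + d) ≡ evalMonic as r + d * evalMonic (quotientMonic as r) (r + d)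
  synthetic-division (a ∷ [])     r d =
    solve 3 (λ a r d → a :+ (r :+ d) :* con 1 := (a :+ r :* con 1) :+ d :* con 1) refl a r d
  synthetic-division (a ∷ b ∷ as) r d =
    trans (cong (λ z → a + (r + d) * z) (synthetic-division (b ∷ as) r d)) 
      (solve 5 (λ a r d e z →
        a :+ (r :+ d) :* (e :+ d :* z) := (a :+ r :* e) :+ d :* (e :+ (r :+ d) :* z)) refl a r d _ _)

  -- Every root other than the first is a root of the quotient, whose degree is one less; the
  -- constant 1 has no roots.
  roots-≤-degree : ∀ {k l} (as : Vec (Fin q) k) (f : Fin l → Fin q) → Injective _≡_ _≡_ f →
    (∀ i → evalMonic as (f i) ≡ 0#) → l ≤ k
  roots-≤-degree {l = zero}  _        _ _   _     = z≤n
  roots-≤-degree {l = suc l} []       f inj roots = contradiction (sym (roots Fin.zero)) 0≢1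
  roots-≤-degree {l = suc l} as@(_ ∷ _) f inj roots =
    s≤s (roots-≤-degree (quotientMonic as r) (λ i → f (Fin.suc i)) (λ e → Fin.suc-injective (inj e)) other-root)
    where
    r = f Fin.zero
    other-root : ∀ i → evalMonic (quotientMonic as r) (f (Fin.suc i)) ≡ 0#
    other-root i = no-zero-divisors (λ e → Fin.0≢1+n (sym (inj (x∙y⁻¹≈ε⇒x≈y _ _ e)))) (begin
      (x + - r) * Q                     ≡⟨ +-identityˡ _ ⟨
      0# + (x + - r) * Q                ≡⟨ cong (_+ (x + - r) * Q) (roots Fin.zero) ⟨
      evalMonic as r + (x + - r) * Q    ≡⟨ divided ⟨
      evalMonic as x                    ≡⟨ roots (Fin.suc i) ⟩
      0#                                ∎)
      where
      x = f (Fin.suc i)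
      Q = evalMonic (quotientMonic as r) x
      divided : evalMonic as x ≡ evalMonic as r + (x + - r) * Q
      divided = subst (λ z → evalMonic as z ≡ evalMonic as r + (x + - r) * evalMonic (quotientMonic as r) z)
        (sym (restore x r)) (synthetic-division as r (x + - r))

  roots-of-unity-≤ : ∀ {k l} → 0 < k → (f : Fin l → Fin q) → Injective _≡_ _≡_ f →
    (∀ i → f i ^ k ≡ 1#) → l ≤ k
  -- The vector lists the lower coefficients of x^(k+1) - 1.
  roots-of-unity-≤ {suc k} _ f inj unity = roots-≤-degree (- 1# ∷ replicate k 0#) f inj (λ i → begin
    - 1# + f i * evalMonic (replicate k 0#) (f i)  ≡⟨ cong (λ z → - 1# + f i * z) (power k (f i)) ⟩
    - 1# + f i ^ suc k                             ≡⟨ cong (- 1# +_) (unity i) ⟩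
    - 1# + 1#                                      ≡⟨ -‿inverseˡ 1# ⟩
    0#                                             ∎)
    where
    power : ∀ k x → evalMonic (replicate k 0#) x ≡ x ^ k
    power zero    x = refl
    power (suc k) x = trans (+-identityˡ _) (cong (x *_) (power k x))

  cons-injective : ∀ {k x} {f : Fin k → Fin q} → Injective _≡_ _≡_ f → ¬ (∃[ i ] (f i ≡ x)) →
    Σ (Fin (suc k) → Fin q) λ g → (Injective _≡_ _≡_ g × g Fin.zero ≡ x × (∀ i → g (Fin.suc i) ≡ f i))
  cons-injective {x = x} {f} inj x∉f = g , g-inj , refl , λ _ → refl
    where
    g : Fin (suc _) → Fin q
    g Fin.zero    = x
    g (Fin.suc i) = f i
    g-inj : Injective _≡_ _≡_ g
    g-inj {Fin.zero}  {Fin.zero}  _ = refl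
    g-inj {Fin.zero}  {Fin.suc j} e = contradiction (j , sym e) x∉f
    g-inj {Fin.suc i} {Fin.zero}  e = contradiction (i , e) x∉f
    g-inj {Fin.suc i} {Fin.suc j} e = cong Fin.suc (inj e)

  -- One more root would give k + 1 roots of a polynomial of degree `k`. This turns counting into
  -- surjectivity.
  roots-of-unity-exhausted : ∀ {k} → 0 < k → (f : Fin k → Fin q) → Injective _≡_ _≡_ f →
    (∀ i → f i ^ k ≡ 1#) → ∀ x → x ^ k ≡ 1# → ∃[ i ] (f i ≡ x)
  roots-of-unity-exhausted {k} 0<k f inj unity x x^k≡1 with any? (λ i → f i Fin.≟ x)
  ... | yes found = found
  ... | no x∉f with g , g-inj , refl , g-suc ← cons-injective inj x∉f =
    contradiction (roots-of-unity-≤ 0<k g g-inj g-unity) (ℕ.<⇒≱ (ℕ.n<1+n k))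
    where
    g-unity : ∀ i → g i ^ k ≡ 1#
    g-unity Fin.zero    = x^k≡1
    g-unity (Fin.suc i) = trans (cong (_^ k) (g-suc i)) (unity i)

  -- Multiplicative orders.

  record HasOrder (x : Fin q) (k : ℕ) : Set where
    field
      positive   : 0 < k
      order-unit : x ^ k ≡ 1#
      order-∣    : ∀ d → x ^ d ≡ 1# → k ∣ d
  open HasOrder

  has-order-≢0 : ∀ {x k} → HasOrder x k → x ≢ 0#
  has-order-≢0 o = unit-≢0 (positive o) (order-unit o)

  order-multiple : ∀ {x k e} → HasOrder x k → k ∣ e → x ^ e ≡ 1#
  order-multiple {x} {k} o = ^-multiple {x} {k} (order-unit o)

  power-difference : ∀ {x a b} → x ≢ 0# → a ≤ b → x ^ a ≡ x ^ b → x ^ (b ∸ a) ≡ 1#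
  power-difference {x} {a} {b} x≢0 a≤b e = sym (*-cancelˡ (^-≢0 a x≢0) (begin
    x ^ a * 1#             ≡⟨ *-identityʳ _ ⟩
    x ^ a                  ≡⟨ e ⟩
    x ^ b                  ≡⟨ cong (x ^_) (ℕ.m+[n∸m]≡n a≤b) ⟨
    x ^ (a ℕ.+ (b ∸ a))    ≡⟨ ^-homo-* x a (b ∸ a) ⟩
    x ^ a * x ^ (b ∸ a)    ∎))

  powers-injective-≤ : ∀ {x k a b} → HasOrder x k → a ≤ b → b < k → x ^ a ≡ x ^ b → a ≡ b
  powers-injective-≤ {x} {k} {a} {b} o a≤b b<k e with b ∸ a in b∸a≡
  ... | zero = ℕ.≤-antisym a≤b (ℕ.m∸n≡0⇒m≤n b∸a≡)
  ... | suc d = contradiction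
    (∣⇒≤ (order-∣ o (suc d) (subst (λ z → x ^ z ≡ 1#) b∸a≡ (power-difference (has-order-≢0 o) a≤b e))))
    (ℕ.<⇒≱ (subst (_< k) b∸a≡ (ℕ.≤-<-trans (ℕ.m∸n≤m b a) b<k)))

  powers-injective : ∀ {x k} → HasOrder x k → ∀ {a b} → a < k → b < k → x ^ a ≡ x ^ b → a ≡ b
  powers-injective {x} {k} o {a} {b} a<k b<k e with ℕ.≤-total a b
  ... | inj₁ a≤b = powers-injective-≤ o a≤b b<k e
  ... | inj₂ b≤a = sym (powers-injective-≤ o b≤a a<k (sym e))

  powers-injective-Fin : ∀ {x k} → HasOrder x k → Injective _≡_ _≡_ (λ (i : Fin k) → x ^ toℕ i)
  powers-injective-Fin o e = toℕ-injective (powers-injective o (toℕ<n _) (toℕ<n _) e)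

  -- Descends through smaller positive unit exponents until none is left; a nonzero remainder of a
  -- unit exponent modulo the last one would be yet another.
  least-unit-exponent : ∀ {x} d → 0 < d → x ^ d ≡ 1# → ∃[ k ] HasOrder x k
  least-unit-exponent {x} d = go d (<-wellFounded d)
    where
    go : ∀ d → Acc _<_ d → 0 < d → x ^ d ≡ 1# → ∃[ k ] HasOrder x k
    go d (acc rec) 0<d x^d≡1
      with any? (λ (i : Fin d) → (0 ℕ.<? toℕ i) ×-dec (x ^ toℕ i Fin.≟ 1#))
    ... | yes (i , 0<i , x^i≡1) = go (toℕ i) (rec (toℕ<n i)) 0<i x^i≡1
    ... | no least = d , record { positive = 0<d ; order-unit = x^d≡1 ; order-∣ = d∣ }
      where
      instance _ = >-nonZero 0<d
      d∣ : ∀ e → x ^ e ≡ 1# → d ∣ e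
      d∣ e x^e≡1 with e % d in e%d≡
      ... | zero = m%n≡0⇒n∣m e d e%d≡
      ... | suc r = contradiction
        (fromℕ< r<d , subst (0 <_) (sym (toℕ-fromℕ< r<d)) z<s ,
         trans (cong (x ^_) (trans (toℕ-fromℕ< r<d) (sym e%d≡))) (trans (sym (^-% x^d≡1 e)) x^e≡1))
        least
        where
        r<d : suc r < d
        r<d = subst (_< d) e%d≡ (m%n<n e d)

  order-exists : ∀ {x} → x ≢ 0# → ∃[ k ] HasOrder x k
  order-exists {x} x≢0 with i , j , i<j , e ← pigeonhole (ℕ.n<1+n q) (λ i → x ^ toℕ i) =
    least-unit-exponent (toℕ j ∸ toℕ i) (ℕ.m<n⇒0<n∸m i<j)
      (power-difference x≢0 (ℕ.<⇒≤ i<j) e)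

  order-^ : ∀ {x} k {l} → HasOrder x (k ℕ.* l) → HasOrder (x ^ k) l
  order-^ {x} k {l} o = record
    { positive = divisor-positive (n∣m*n k) (positive o)
    ; order-unit = trans (^-assocʳ x k l) (order-unit o)
    ; order-∣ = λ d e → *-cancelˡ-∣ k {{>-nonZero (divisor-positive (m∣m*n l) (positive o))}}
        (order-∣ o (k ℕ.* d) (trans (sym (^-assocʳ x k d)) e)) }

  order-^-coprime : ∀ {x k e} → HasOrder x k → Coprime k e → HasOrder (x ^ e) k
  order-^-coprime {x} {k} {e} o co = record
    { positive = positive o
    ; order-unit = trans (^-swap x e k) (trans (cong (_^ e) (order-unit o)) (1^ e))
    ; order-∣ = λ d x^ed≡1 → coprime-divisor co (order-∣ o (e ℕ.* d) (trans (sym (^-assocʳ x e d)) x^ed≡1)) }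

  -- Raising a relation `(x * y) ^ d ≡ 1#` to the power `l` kills `y` and gives `k ∣ l * d`, hence
  -- `k ∣ d`; likewise with the roles exchanged.
  order-* : ∀ {x y k l} → HasOrder x k → HasOrder y l → Coprime k l → HasOrder (x * y) (k ℕ.* l)
  order-* {x} {y} {k} {l} ox oy co = record
    { positive = ℕ.*-mono-< (positive ox) (positive oy)
    ; order-unit = trans (^-distrib-* x y (k ℕ.* l))
        (trans (cong₂ _*_ (order-multiple ox (m∣m*n l)) (order-multiple oy (n∣m*n k)))
               (*-identityˡ 1#))
    ; order-∣ = λ d e → coprime-*∣ co
        (coprime-divisor co (order-∣ ox (l ℕ.* d) (killˡ d e)))
        (coprime-divisor (Coprime.sym co) (order-∣ oy (k ℕ.* d) (killʳ d e))) }
    where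
    expand : ∀ d f → (x * y) ^ d ≡ 1# → x ^ (f ℕ.* d) * y ^ (f ℕ.* d) ≡ 1#
    expand d f e = begin
      x ^ (f ℕ.* d) * y ^ (f ℕ.* d) ≡⟨ ^-distrib-* x y (f ℕ.* d) ⟨
      (x * y) ^ (f ℕ.* d)           ≡⟨ ^-multiple e (n∣m*n f) ⟩
      1#                            ∎
    killˡ : ∀ d → (x * y) ^ d ≡ 1# → x ^ (l ℕ.* d) ≡ 1#
    killˡ d e = begin
      x ^ (l ℕ.* d)                  ≡⟨ *-identityʳ _ ⟨
      x ^ (l ℕ.* d) * 1#             ≡⟨ cong (x ^ (l ℕ.* d) *_) (order-multiple oy (m∣m*n d)) ⟨
      x ^ (l ℕ.* d) * y ^ (l ℕ.* d)  ≡⟨ expand d l e ⟩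
      1#                             ∎
    killʳ : ∀ d → (x * y) ^ d ≡ 1# → y ^ (k ℕ.* d) ≡ 1#
    killʳ d e = begin
      y ^ (k ℕ.* d)                  ≡⟨ *-identityˡ _ ⟨
      1# * y ^ (k ℕ.* d)             ≡⟨ cong (_* y ^ (k ℕ.* d)) (order-multiple ox (m∣m*n d)) ⟨
      x ^ (k ℕ.* d) * y ^ (k ℕ.* d)  ≡⟨ expand d k e ⟩
      1#                             ∎

  -- Existence of a primitive element.

  common-exponent : ∀ (xs : List (Fin q)) →
    ∃₂ λ g N → HasOrder g N × (∀ {x} → x ∈ xs → x ≢ 0# → x ^ N ≡ 1#)
  common-exponent [] = 1# , 1 ,
    record { positive = z<s ; order-unit = *-identityʳ 1# ; order-∣ = λ d _ → divides d (sym (ℕ.*-identityʳ d)) } ,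
    λ ()
  common-exponent (x ∷ xs) with common-exponent xs | x Fin.≟ 0#
  ... | g , N , o , all | yes x≡0 =
    g , N , o , λ { (here refl) x≢0 → contradiction x≡0 x≢0 ; (there y∈) → all y∈ }
  -- For a coprime split of the orders `k` and `N`, the powers of `x` and `g` with exponents `k / s`
  -- and `N / t` have coprime orders `s` and `t`. Their product has order `s * t`, a multiple of
  -- both `k` and `N`.
  ... | g , N , o , all | no x≢0
    with k , ok ← order-exists x≢0
    with s , t , sp ← coprime-split k N (positive ok) (positive o)
    with record { s∣m = divides k′ refl ; t∣n = divides N′ refl ; coprime = co ; m∣s*t = k∣ ; n∣s*t = N∣ } ← sp =
    x ^ k′ * g ^ N′ , s ℕ.* t , order-* (order-^ k′ ok) (order-^ N′ o) co ,
    λ { (here refl) _ → order-multiple ok k∣ ; (there y∈) y≢0 → ^-multiple (all y∈ y≢0) N∣ }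

  -- All nonzero elements satisfy x^k = 1 for the order `k` of `g`, so they are powers of `g`.
  -- Counting zero together with these powers gives k + 1 = q.
  primitive-element : ∀ {N} → q ≡ suc N →
    ∃[ g ] (HasOrder g N × (∀ x → x ≢ 0# → x ^ N ≡ 1#))
  primitive-element {N} q≡ with common-exponent (allFin q)
  ... | g , k , o , all with k≡N
    where
    log : ∀ x → x ≢ 0# → ∃[ i ] (g ^ toℕ {k} i ≡ x)
    log x x≢0 = roots-of-unity-exhausted (positive o) (λ i → g ^ toℕ i) (powers-injective-Fin o)
      (λ i → all (∈-allFin _) (^-≢0 (toℕ i) (has-order-≢0 o))) x (all (∈-allFin x) x≢0)
    exp≤ : suc k ≤ q
    exp≤ with h , h-inj , _ ← cons-injective (powers-injective-Fin o)
                (λ (i , e) → ^-≢0 (toℕ i) (has-order-≢0 o) e) = injective⇒≤ h-inj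
    log-or-zero : Fin q → Fin (suc k)
    log-or-zero x with x Fin.≟ 0#
    ... | yes _ = Fin.zero
    ... | no x≢0 = Fin.suc (proj₁ (log x x≢0))
    log-or-zero-injective : Injective _≡_ _≡_ log-or-zero
    log-or-zero-injective {x} {y} e with x Fin.≟ 0# | y Fin.≟ 0#
    ... | yes x≡0 | yes y≡0 = trans x≡0 (sym y≡0)
    ... | no x≢0  | no y≢0  = trans (sym (proj₂ (log x x≢0)))
      (trans (cong (λ i → g ^ toℕ i) (Fin.suc-injective e)) (proj₂ (log y y≢0)))
    k≡N : k ≡ N
    k≡N = ℕ.suc-injective (trans (ℕ.≤-antisym exp≤ (injective⇒≤ log-or-zero-injective)) q≡)
  ... | refl = g , o , λ x → all (∈-allFin x)

  -- Multiplications permuting a finite family.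

  injective-scaling : ∀ {m x y} {f : Fin m → Fin q} → Injective _≡_ _≡_ f → x * y ≡ 1# →
    (∀ i → ∃[ i′ ] (x * f i ≡ f i′)) → (∀ i → ∃[ i′ ] (y * f i ≡ f i′)) →
    Σ (Fin m ↔ Fin m) λ σ → ∀ i → x * f i ≡ f (Inverse.to σ i)
  injective-scaling {x = x} {y} {f} inj xy≡1 by-x by-y =
    mk↔ₛ′ (λ i → proj₁ (by-x i)) (λ i → proj₁ (by-y i))
      (λ i → undo xy≡1 (proj₂ (by-y i)) (proj₂ (by-x _)))
      (λ i → undo (trans (*-comm y x) xy≡1) (proj₂ (by-x i)) (proj₂ (by-y _))) ,
    λ i → proj₂ (by-x i)
    where
    undo : ∀ {a b i j k} → a * b ≡ 1# → b * f i ≡ f j → a * f j ≡ f k → k ≡ i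
    undo {a} {b} {i} {j} {k} ab≡1 bi aj = inj (begin
      f k             ≡⟨ aj ⟨
      a * f j         ≡⟨ cong (a *_) bi ⟨
      a * (b * f i)   ≡⟨ *-assoc a b (f i) ⟨
      (a * b) * f i   ≡⟨ cong (_* f i) ab≡1 ⟩
      1# * f i        ≡⟨ *-identityˡ (f i) ⟩
      f i             ∎)

  sumF≡sum : ∀ {k} (f : Fin k → Fin q) → sumF F f ≡ sum f
  sumF≡sum {zero}  f = refl
  sumF≡sum {suc k} f = cong (f Fin.zero +_) (sumF≡sum (λ i → f (Fin.suc i)))

  -- Multiplication by `x` only permutes the terms, so the sum S satisfies x S = S, and `x ≢ 1#`
  -- forces S = 0.
  scaling-sum : ∀ {m x} (f : Fin m → Fin q) (σ : Fin m ↔ Fin m) → x ≢ 1# →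
    (∀ i → x * f i ≡ f (Inverse.to σ i)) → sum f ≡ 0#
  scaling-sum {x = x} f σ x≢1 scale with sum f Fin.≟ 0#
  ... | yes Σ≡0 = Σ≡0
  ... | no Σ≢0 = contradiction (*-cancelʳ Σ≢0 (begin
    x * sum f                       ≡⟨ *-distribˡ-sum x f ⟩
    sum (λ i → x * f i)             ≡⟨ sum-cong-≗ scale ⟩
    sum (λ i → f (Inverse.to σ i))  ≡⟨ sum-permute f σ ⟨
    sum f                           ≡⟨ *-identityˡ _ ⟨
    1# * sum f                      ∎)) x≢1

  ∏-≢0 : ∀ {m} (f : Fin m → Fin q) → (∀ i → f i ≢ 0#) → ∏ f ≢ 0#
  ∏-≢0 {zero}  f f≢0 1≡0 = 0≢1 (sym 1≡0)
  ∏-≢0 {suc m} f f≢0 = *-≢0 (f≢0 Fin.zero) (∏-≢0 (λ i → f (Fin.suc i)) (λ i → f≢0 (Fin.suc i)))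

  ∏-scale : ∀ {m} x (f : Fin m → Fin q) → ∏ (λ i → x * f i) ≡ x ^ m * ∏ f
  ∏-scale {zero}  x f = sym (*-identityˡ 1#)
  ∏-scale {suc m} x f = trans (cong (x * f Fin.zero *_) (∏-scale x (λ i → f (Fin.suc i))))
    (interchange x (f Fin.zero) (x ^ m) _)

  scaling-unit : ∀ {m x} (f : Fin m → Fin q) (σ : Fin m ↔ Fin m) → (∀ i → f i ≢ 0#) →
    (∀ i → x * f i ≡ f (Inverse.to σ i)) → x ^ m ≡ 1#
  scaling-unit {m} {x} f σ f≢0 scale = *-cancelʳ (∏-≢0 f f≢0) (begin
    x ^ m * ∏ f                   ≡⟨ ∏-scale x f ⟨
    ∏ (λ i → x * f i)             ≡⟨ ∏-cong scale ⟩
    ∏ (λ i → f (Inverse.to σ i))  ≡⟨ ∏-permute f σ ⟨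
    ∏ f                           ≡⟨ *-identityˡ _ ⟨
    1# * ∏ f                      ∎)

  -- An involution in the group of scalings would make two entries agree up to sign, so this
  -- group has odd order.
  scaling-odd-unit : ∀ {m x} (f : Fin m → Fin q) (σ : Fin m ↔ Fin m) → Fin m → (∀ i → f i ≢ 0#) →
    (∀ {i j} → f i ^ 2 ≡ f j ^ 2 → i ≡ j) → (∀ i → x * f i ≡ f (Inverse.to σ i)) →
    ∀ o e → m ≡ o ℕ.* 2 ℕ.^ e → x ^ o ≡ 1#
  scaling-odd-unit {m} {x} f σ i₀ f≢0 sq-inj scale o e refl =
    descend e (scaling-unit f σ f≢0 scale)
    where
    orbit : ∀ d i → ∃[ i′ ] (x ^ d * f i ≡ f i′)
    orbit zero    i = i , *-identityˡ (f i)
    orbit (suc d) i with i′ , eq ← orbit d i =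
      Inverse.to σ i′ , trans (*-assoc x (x ^ d) (f i)) (trans (cong (x *_) eq) (scale i′))
    -- A power of `x` with square 1 takes `f i₀` to an entry with the same square, hence to itself.
    no-involution : ∀ d → (x ^ d) ^ 2 ≡ 1# → x ^ d ≡ 1#
    no-involution d sq≡1 with i′ , eq ← orbit d i₀ = *-cancelʳ (f≢0 i₀) (begin
      x ^ d * f i₀  ≡⟨ eq ⟩
      f i′          ≡⟨ cong f (sq-inj (begin
        f i′ ^ 2                ≡⟨ cong (_^ 2) eq ⟨
        (x ^ d * f i₀) ^ 2      ≡⟨ ^-distrib-* (x ^ d) (f i₀) 2 ⟩
        (x ^ d) ^ 2 * f i₀ ^ 2  ≡⟨ cong (_* f i₀ ^ 2) sq≡1 ⟩
        1# * f i₀ ^ 2           ≡⟨ *-identityˡ _ ⟩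
        f i₀ ^ 2                ∎)) ⟩
      f i₀          ≡⟨ *-identityˡ _ ⟨
      1# * f i₀     ∎)
    descend : ∀ e → x ^ (o ℕ.* 2 ℕ.^ e) ≡ 1# → x ^ o ≡ 1#
    descend zero    h = subst (λ d → x ^ d ≡ 1#) (ℕ.*-identityʳ o) h
    descend (suc e) h = descend e (no-involution (o ℕ.* 2 ℕ.^ e)
      (trans (^-assocʳ x (o ℕ.* 2 ℕ.^ e) 2) (trans (cong (x ^_) (reorder o (2 ℕ.^ e))) h)))
      where
      reorder : ∀ o p → (o ℕ.* p) ℕ.* 2 ≡ o ℕ.* (2 ℕ.* p)
      reorder = solve-∀

  -- Unions of cosets of a cyclic subgroup.

  cosetEntry : ∀ (h ω : Fin q) {k s} → Fin k × Fin s → Fin q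
  cosetEntry h ω (c , a) = h ^ toℕ c * ω ^ toℕ a

  -- For `ω` of order `s`, this enumerates the union of the cosets of the subgroup generated by `ω`
  -- with representatives `h ^ c`, c < k.
  cosets : ∀ (h ω : Fin q) k s → Fin (k ℕ.* s) → Fin q
  cosets h ω k s i = cosetEntry h ω (remQuot {k} s i)

  cosets-≢0 : ∀ {h ω} k s → h ≢ 0# → ω ≢ 0# → ∀ i → cosets h ω k s i ≢ 0#
  cosets-≢0 k s h≢0 ω≢0 i =
    *-≢0 (^-≢0 (toℕ (proj₁ (remQuot {k} s i))) h≢0) (^-≢0 (toℕ (proj₂ (remQuot {k} s i))) ω≢0)

  cosets-shift : ∀ {h ω} k {s} → HasOrder ω s → ∀ e i →
    ∃[ i′ ] (ω ^ e * cosets h ω k s i ≡ cosets h ω k s i′)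
  cosets-shift {h} {ω} k {s} o e i = combine c (fromℕ< r<s) , (begin
    ω ^ e * (h ^ toℕ c * ω ^ toℕ a)   ≡⟨ x∙yz≈y∙xz (ω ^ e) (h ^ toℕ c) (ω ^ toℕ a) ⟩
    h ^ toℕ c * (ω ^ e * ω ^ toℕ a)   ≡⟨ cong (h ^ toℕ c *_) (^-homo-* ω e (toℕ a)) ⟨
    h ^ toℕ c * ω ^ (e ℕ.+ toℕ a)     ≡⟨ cong (h ^ toℕ c *_) (^-% (order-unit o) (e ℕ.+ toℕ a)) ⟩
    h ^ toℕ c * ω ^ ((e ℕ.+ toℕ a) % s) ≡⟨ cong (λ z → h ^ toℕ c * ω ^ z) (toℕ-fromℕ< r<s) ⟨
    cosetEntry h ω (c , fromℕ< r<s)   ≡⟨ cong (cosetEntry h ω) (remQuot-combine c (fromℕ< r<s)) ⟨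
    cosets h ω k s (combine c (fromℕ< r<s)) ∎)
    where
    instance _ = >-nonZero (positive o)
    c = proj₁ (remQuot {k} s i)
    a = proj₂ (remQuot {k} s i)
    r<s : (e ℕ.+ toℕ a) % s < s
    r<s = m%n<n (e ℕ.+ toℕ a) s

  cosets-scaling : ∀ {h ω} k {s} → HasOrder ω s → Injective _≡_ _≡_ (cosets h ω k s) → ∀ e →
    Σ (Fin (k ℕ.* s) ↔ Fin (k ℕ.* s)) λ σ →
      ∀ i → ω ^ e * cosets h ω k s i ≡ cosets h ω k s (Inverse.to σ i)
  cosets-scaling {h} {ω} k {suc s} o inj e =
    -- The order is `suc s` here, so `ω ^ (e * s)` inverts `ω ^ e`.
    injective-scaling inj inverse-power (cosets-shift k o e) (cosets-shift k o (e ℕ.* s))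
    where
    inverse-power : ω ^ e * ω ^ (e ℕ.* s) ≡ 1#
    inverse-power = trans (sym (^-homo-* ω e (e ℕ.* s)))
      (order-multiple o (divides e (sym (ℕ.*-suc e s))))

  cosets-sum : ∀ {h ω} k {s} → 1 < s → HasOrder ω s → Injective _≡_ _≡_ (cosets h ω k s) →
    sum (cosets h ω k s) ≡ 0#
  cosets-sum {h} {ω} k {s} 1<s o inj with σ , scale ← cosets-scaling {h} k o inj 1 =
    scaling-sum (cosets h ω k s) σ (λ ω≡1 → ℕ.<⇒≱ 1<s (∣⇒≤ (order-∣ o 1 ω≡1))) scale

  -- The array and its Heffter property.

  module Construction (k s l t : ℕ) (0<k : 0 < k) (0<l : 0 < l) (1<s : 1 < s) (1<t : 1 < t)
    (coprime-st : Coprime s t) (coprime-s2 : Coprime s 2) (coprime-t2 : Coprime t 2)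
    (g ω θ : Fin q) (unit-exponent : ∀ x → x ≢ 0# → x ^ (2 ℕ.* (k ℕ.* s) ℕ.* (l ℕ.* t)) ≡ 1#)
    (g≢0 : g ≢ 0#) (ω-order : HasOrder ω s) (θ-order : HasOrder θ t)
    (ζ-order : HasOrder (g ^ (2 ℕ.* (s ℕ.* t))) (l ℕ.* k)) where

    -- Raising to the power 2st kills signs and the subgroup generated by `ω` and `θ`; the powers of
    -- `ζ` tell the remaining k l cosets apart.
    ζ : Fin q
    ζ = g ^ (2 ℕ.* (s ℕ.* t))

    u : Fin (k ℕ.* s) → Fin q
    u = cosets g ω k s

    v : Fin (l ℕ.* t) → Fin q
    v = cosets (g ^ k) θ l t

    A : Matrix F (k ℕ.* s) (l ℕ.* t)
    A i j = u i * v j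

    u≢0 : ∀ i → u i ≢ 0#
    u≢0 = cosets-≢0 k s g≢0 (has-order-≢0 ω-order)

    v≢0 : ∀ j → v j ≢ 0#
    v≢0 = cosets-≢0 l t (^-≢0 k g≢0) (has-order-≢0 θ-order)

    A≢0 : ∀ i j → A i j ≢ 0#
    A≢0 i j = *-≢0 (u≢0 i) (v≢0 j)

    drop-unit : ∀ {x y e} a → y ^ e ≡ 1# → (x * y ^ a) ^ e ≡ x ^ e
    drop-unit {x} {y} {e} a y^e≡1 = begin
      (x * y ^ a) ^ e      ≡⟨ ^-distrib-* x (y ^ a) e ⟩
      x ^ e * (y ^ a) ^ e  ≡⟨ cong (x ^ e *_) (trans (^-swap y a e) (trans (cong (_^ a) y^e≡1) (1^ a))) ⟩
      x ^ e * 1#           ≡⟨ *-identityʳ _ ⟩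
      x ^ e                ∎

    double-power : ∀ {x y} e → x ^ 2 ≡ y ^ 2 → x ^ (2 ℕ.* e) ≡ y ^ (2 ℕ.* e)
    double-power {x} {y} e eq = trans (sym (^-assocʳ x 2 e)) (trans (cong (_^ e) eq) (^-assocʳ y 2 e))

    U : Fin k × Fin s → Fin q
    U = cosetEntry g ω

    V : Fin l × Fin t → Fin q
    V = cosetEntry (g ^ k) θ

    -- Representatives contribute the exponent k d + c, which is the mixed-radix number of the pair
    -- (d, c) and so determines it.
    forget-cosets : ∀ c a d b →
      (U (c , a) * V (d , b)) ^ (2 ℕ.* (s ℕ.* t)) ≡ ζ ^ toℕ (combine d c)
    forget-cosets c a d b = begin
      (U (c , a) * V (d , b)) ^ E        ≡⟨ ^-distrib-* (U (c , a)) (V (d , b)) E ⟩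
      U (c , a) ^ E * V (d , b) ^ E      ≡⟨ cong₂ _*_
        (drop-unit {e = E} (toℕ a) (order-multiple ω-order (divides (2 ℕ.* t) (eqω s t))))
        (drop-unit {e = E} (toℕ b) (order-multiple θ-order (divides (2 ℕ.* s) (sym (ℕ.*-assoc 2 s t))))) ⟩
      (g ^ toℕ c) ^ E * ((g ^ k) ^ toℕ d) ^ E
        ≡⟨ cong₂ _*_ (^-swap g (toℕ c) E)
             (trans (cong (_^ E) (^-assocʳ g k (toℕ d))) (^-swap g (k ℕ.* toℕ d) E)) ⟩
      ζ ^ toℕ c * ζ ^ (k ℕ.* toℕ d)      ≡⟨ *-comm _ _ ⟩
      ζ ^ (k ℕ.* toℕ d) * ζ ^ toℕ c      ≡⟨ ^-homo-* ζ (k ℕ.* toℕ d) (toℕ c) ⟨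
      ζ ^ (k ℕ.* toℕ d ℕ.+ toℕ c)        ≡⟨ cong (ζ ^_) (toℕ-combine d c) ⟨
      ζ ^ toℕ (combine d c)              ∎
      where
      E = 2 ℕ.* (s ℕ.* t)
      eqω : ∀ s t → 2 ℕ.* (s ℕ.* t) ≡ 2 ℕ.* t ℕ.* s
      eqω = solve-∀

    same-cosets : ∀ c d a b a′ b′ → (U (c , a) * V (d , b)) ^ 2 ≡ (U (c , a′) * V (d , b′)) ^ 2 →
      (ω ^ toℕ a * θ ^ toℕ b) ^ 2 ≡ (ω ^ toℕ a′ * θ ^ toℕ b′) ^ 2
    same-cosets c d a b a′ b′ e = *-cancelˡ (^-≢0 2 R≢0) (begin
      R ^ 2 * (ω ^ toℕ a * θ ^ toℕ b) ^ 2    ≡⟨ pull a b ⟨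
      (U (c , a) * V (d , b)) ^ 2            ≡⟨ e ⟩
      (U (c , a′) * V (d , b′)) ^ 2          ≡⟨ pull a′ b′ ⟩
      R ^ 2 * (ω ^ toℕ a′ * θ ^ toℕ b′) ^ 2  ∎)
      where
      R = g ^ toℕ c * (g ^ k) ^ toℕ d
      R≢0 : R ≢ 0#
      R≢0 = *-≢0 (^-≢0 (toℕ c) g≢0) (^-≢0 (toℕ d) (^-≢0 k g≢0))
      pull : ∀ a b → (U (c , a) * V (d , b)) ^ 2 ≡ R ^ 2 * (ω ^ toℕ a * θ ^ toℕ b) ^ 2
      pull a b = trans (cong (_^ 2) (interchange (g ^ toℕ c) (ω ^ toℕ a) ((g ^ k) ^ toℕ d) (θ ^ toℕ b)))
        (^-distrib-* R _ 2)

    -- Equal squares mean equality up to sign. The power 2st recovers `c` and `d`. After cancelling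
    -- the representatives, the power 2t removes `θ` and leaves powers of `ω ^ (2t)`, still of order
    -- `s` as `s` is coprime to 2t; this recovers `a`, and symmetrically `b`.
    entries-injective : ∀ c a d b c′ a′ d′ b′ →
      (U (c , a) * V (d , b)) ^ 2 ≡ (U (c′ , a′) * V (d′ , b′)) ^ 2 →
      (c , a) ≡ (c′ , a′) × (d , b) ≡ (d′ , b′)
    entries-injective c a d b c′ a′ d′ b′ e
      with combine-injective d c d′ c′ (powers-injective-Fin {x = ζ} ζ-order
        (trans (sym (forget-cosets c a d b))
          (trans (double-power (s ℕ.* t) e) (forget-cosets c′ a′ d′ b′))))
    ... | refl , refl = cong (c ,_) a≡a′ , cong (d ,_) b≡b′
      where
      e′ = same-cosets c d a b a′ b′ e
      onω : ∀ a b → (ω ^ toℕ {s} a * θ ^ toℕ {t} b) ^ (2 ℕ.* t) ≡ (ω ^ (2 ℕ.* t)) ^ toℕ a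
      onω a b = trans (drop-unit {e = 2 ℕ.* t} (toℕ b) (order-multiple θ-order (n∣m*n 2))) (^-swap ω (toℕ a) (2 ℕ.* t))
      onθ : ∀ a b → (ω ^ toℕ {s} a * θ ^ toℕ {t} b) ^ (2 ℕ.* s) ≡ (θ ^ (2 ℕ.* s)) ^ toℕ b
      onθ a b = trans (cong (_^ (2 ℕ.* s)) (*-comm _ _))
        (trans (drop-unit {e = 2 ℕ.* s} (toℕ a) (order-multiple ω-order (n∣m*n 2))) (^-swap θ (toℕ b) (2 ℕ.* s)))
      a≡a′ : a ≡ a′
      a≡a′ = powers-injective-Fin {x = ω ^ (2 ℕ.* t)}
        (order-^-coprime ω-order (Coprime.sym (coprime-* (Coprime.sym coprime-s2) (Coprime.sym coprime-st))))
        (trans (sym (onω a b)) (trans (double-power t e′) (onω a′ b′)))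
      b≡b′ : b ≡ b′
      b≡b′ = powers-injective-Fin {x = θ ^ (2 ℕ.* s)}
        (order-^-coprime θ-order (Coprime.sym (coprime-* (Coprime.sym coprime-t2) coprime-st)))
        (trans (sym (onθ a b)) (trans (double-power s e′) (onθ a′ b′)))

    A-squares-injective : ∀ i j i′ j′ → A i j ^ 2 ≡ A i′ j′ ^ 2 → i ≡ i′ × j ≡ j′
    A-squares-injective i j i′ j′ e with entries-injective _ _ _ _ _ _ _ _ e
    ... | i≡ , j≡ = remQuot-injective k s i≡ , remQuot-injective l t j≡

    A-injective : ∀ i j i′ j′ → A i j ≡ A i′ j′ → i ≡ i′ × j ≡ j′
    A-injective i j i′ j′ e = A-squares-injective i j i′ j′ (cong (_^ 2) e)

    i₀ i₁ : Fin (k ℕ.* s)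
    i₀ = fromℕ< (ℕ.*-mono-< 0<k (ℕ.<-trans z<s 1<s))
    i₁ = fromℕ< (ℕ.*-mono-≤ 0<k 1<s)

    i₀≢i₁ : i₀ ≢ i₁
    i₀≢i₁ e = contradiction
      (trans (sym (toℕ-fromℕ< _)) (trans (cong toℕ e) (toℕ-fromℕ< (ℕ.*-mono-≤ 0<k 1<s)))) λ ()

    j₀ : Fin (l ℕ.* t)
    j₀ = fromℕ< (ℕ.*-mono-< 0<l (ℕ.<-trans z<s 1<t))

    u-squares-injective : ∀ {i i′} → u i ^ 2 ≡ u i′ ^ 2 → i ≡ i′
    u-squares-injective {i} {i′} e = proj₁ (A-squares-injective i j₀ i′ j₀
      (trans (^-distrib-* (u i) (v j₀) 2) (trans (cong (_* v j₀ ^ 2) e) (sym (^-distrib-* (u i′) (v j₀) 2)))))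

    v-squares-injective : ∀ {j j′} → v j ^ 2 ≡ v j′ ^ 2 → j ≡ j′
    v-squares-injective {j} {j′} e = proj₂ (A-squares-injective i₀ j i₀ j′
      (trans (^-distrib-* (u i₀) (v j) 2) (trans (cong (u i₀ ^ 2 *_) e) (sym (^-distrib-* (u i₀) (v j′) 2)))))

    u-injective : Injective _≡_ _≡_ u
    u-injective e = u-squares-injective (cong (_^ 2) e)

    v-injective : Injective _≡_ _≡_ v
    v-injective e = v-squares-injective (cong (_^ 2) e)

    -- The squares of the entries are mn distinct roots of x^mn = 1, hence all of them.
    entries-cover : ∀ x → x ≢ 0# → ∃[ i ] ∃[ j ] (A i j ≡ x ⊎ A i j ≡ - x)
    entries-cover x x≢0 =
      let (_ , sq) = roots-of-unity-exhausted (ℕ.*-mono-< (ℕ.≤-<-trans z≤n (toℕ<n i₀)) (ℕ.≤-<-trans z≤n (toℕ<n j₀)))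
              (λ e → uncurry A (remQuot {k ℕ.* s} (l ℕ.* t) e) ^ 2)
              (λ {e} {e′} eq → let (i≡ , j≡) = A-squares-injective _ _ _ _ eq
                               in remQuot-injective (k ℕ.* s) (l ℕ.* t) (cong₂ _,_ i≡ j≡))
              (λ e → squared-unit (A≢0 _ _)) (x ^ 2) (squared-unit x≢0)
      in _ , _ , squares-equal sq
      where
      squared-unit : ∀ {y} → y ≢ 0# → (y ^ 2) ^ (k ℕ.* s ℕ.* (l ℕ.* t)) ≡ 1#
      squared-unit {y} y≢0 = trans (^-assocʳ y 2 (k ℕ.* s ℕ.* (l ℕ.* t)))
        (trans (cong (y ^_) (sym (ℕ.*-assoc 2 (k ℕ.* s) (l ℕ.* t)))) (unit-exponent y y≢0))

    isHeffter : IsHeffter F A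
    isHeffter =
      (A-injective , A≢0 , entries-cover) ,
      (λ i → begin
        sumF F (λ j → u i * v j)  ≡⟨ sumF≡sum (λ j → u i * v j) ⟩
        sum (λ j → u i * v j)     ≡⟨ *-distribˡ-sum (u i) v ⟨
        u i * sum v               ≡⟨ cong (u i *_) (cosets-sum l 1<t θ-order v-injective) ⟩
        u i * 0#                  ≡⟨ zeroʳ (u i) ⟩
        0#                        ∎) ,
      (λ j → begin
        sumF F (λ i → u i * v j)  ≡⟨ sumF≡sum (λ i → u i * v j) ⟩
        sum (λ i → u i * v j)     ≡⟨ *-distribʳ-sum (v j) u ⟨
        sum u * v j               ≡⟨ cong (_* v j) (cosets-sum k 1<s ω-order u-injective) ⟩
        0# * v j                  ≡⟨ zeroˡ (v j) ⟩
        0#                        ∎)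

    isRankOne : IsRankOne F A
    isRankOne = (u , v , λ _ _ → refl) , i₀ , j₀ , A≢0 i₀ j₀

    -- The multiplier group of the array.

    η : Fin q
    η = ω * θ

    η-order : HasOrder η (s ℕ.* t)
    η-order = order-* ω-order θ-order coprime-st

    powers-multiply : ∀ e → IsMultiplier F A (η ^ e)
    powers-multiply e
      with σ , scaleσ ← cosets-scaling k ω-order u-injective e
         | τ , scaleτ ← cosets-scaling l θ-order v-injective e =
      ^-≢0 e (has-order-≢0 η-order) , inj₁ (σ , τ , λ i j → begin
        η ^ e * (u i * v j)              ≡⟨ cong (_* (u i * v j)) (^-distrib-* ω θ e) ⟩
        (ω ^ e * θ ^ e) * (u i * v j)    ≡⟨ interchange (ω ^ e) (θ ^ e) (u i) (v j) ⟩
        (ω ^ e * u i) * (θ ^ e * v j)    ≡⟨ cong₂ _*_ (scaleσ i) (scaleτ j) ⟩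
        u (Inverse.to σ i) * v (Inverse.to τ j)  ∎)

    -- Such a `w` would make the entries of `v`, reindexed by the inverse of `σ`, proportional to
    -- those of `u`. Then `A i₀ j₁` and `A i₁ j₀′` coincide although their rows differ.
    no-transposed-multiplier : ∀ {w} → w ≢ 0# →
      (σ : Fin (l ℕ.* t) ↔ Fin (k ℕ.* s)) (τ : Fin (k ℕ.* s) ↔ Fin (l ℕ.* t)) →
      ¬ (∀ i j → w * A i j ≡ A (Inverse.to σ j) (Inverse.to τ i))
    no-transposed-multiplier {w} w≢0 σ τ eq = i₀≢i₁ (proj₁ (A-injective i₀ j₁ i₁ j₀′
      (*-cancelˡ (*-≢0 w≢0 (u≢0 i₀)) (begin
        (w * u i₀) * (u i₀ * v j₁)                          ≡⟨ x∙yz≈y∙xz (w * u i₀) (u i₀) (v j₁) ⟩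
        u i₀ * ((w * u i₀) * v j₁)                          ≡⟨ cong (u i₀ *_) (proportional i₁) ⟩
        u i₀ * (u i₁ * V₀)                                  ≡⟨ x∙yz≈y∙xz (u i₀) (u i₁) V₀ ⟩
        u i₁ * (u i₀ * V₀)                                  ≡⟨ cong (u i₁ *_) (proportional i₀) ⟨
        u i₁ * ((w * u i₀) * v j₀′)                         ≡⟨ x∙yz≈y∙xz (w * u i₀) (u i₁) (v j₀′) ⟨
        (w * u i₀) * (u i₁ * v j₀′)                         ∎))))
      where
      V₀ = v (Inverse.to τ i₀)
      j₁ = Inverse.from σ i₁
      j₀′ = Inverse.from σ i₀
      proportional : ∀ i → (w * u i₀) * v (Inverse.from σ i) ≡ u i * V₀
      proportional i = trans (*-assoc w (u i₀) (v (Inverse.from σ i)))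
        (trans (eq i₀ (Inverse.from σ i)) (cong (λ z → u z * V₀) (Inverse.strictlyInverseˡ σ i)))

    module _ (m₀ n₀ e f : ℕ) (m≡ : k ℕ.* s ≡ m₀ ℕ.* 2 ℕ.^ e) (n≡ : l ℕ.* t ≡ n₀ ℕ.* 2 ℕ.^ f)
      (m₀∣st : m₀ ∣ s ℕ.* t) (n₀∣st : n₀ ∣ s ℕ.* t) where

      -- The multiplier factors as `α * β` with `α` permuting the entries of `u` and `β` those of
      -- `v`. Hence `α ^ m₀` and `β ^ n₀` are 1, and both exponents divide `s * t`.
      straight-multiplier : ∀ {w} (σ : Fin (k ℕ.* s) ↔ Fin (k ℕ.* s)) (τ : Fin (l ℕ.* t) ↔ Fin (l ℕ.* t)) →
        (∀ i j → w * A i j ≡ A (Inverse.to σ i) (Inverse.to τ j)) → w ^ (s ℕ.* t) ≡ 1#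
      straight-multiplier {w} σ τ eq = begin
        w ^ (s ℕ.* t)                       ≡⟨ cong (_^ (s ℕ.* t)) w≡αβ ⟩
        (α * β) ^ (s ℕ.* t)                 ≡⟨ ^-distrib-* α β (s ℕ.* t) ⟩
        α ^ (s ℕ.* t) * β ^ (s ℕ.* t)       ≡⟨ cong₂ _*_
          (^-multiple {α} {m₀} (scaling-odd-unit u σ i₀ u≢0 u-squares-injective scaleσ m₀ e m≡) m₀∣st)
          (^-multiple {β} {n₀} (scaling-odd-unit v τ j₀ v≢0 v-squares-injective scaleτ n₀ f n≡) n₀∣st) ⟩
        1# * 1#                             ≡⟨ *-identityˡ 1# ⟩
        1#                                  ∎
        where
        σ⟨_⟩ = Inverse.to σ
        τ⟨_⟩ = Inverse.to τ
        V₀ = v τ⟨ j₀ ⟩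
        V₀⁻¹ = proj₁ (inverse V₀ (v≢0 _))
        v₀⁻¹ = proj₁ (inverse (v j₀) (v≢0 j₀))
        -- Column `j₀` goes to column `τ⟨ j₀ ⟩`; the ratio of the two entries of `v` is `β`, and `α`
        -- is `w` divided by `β`.
        α β : Fin q
        α = w * v j₀ * V₀⁻¹
        β = V₀ * v₀⁻¹
        w≡αβ : w ≡ α * β
        w≡αβ = begin
          w                                ≡⟨ *-identityʳ w ⟨
          w * 1#                           ≡⟨ cong (w *_) (*-identityˡ 1#) ⟨
          w * (1# * 1#)                    ≡⟨ cong₂ (λ a b → w * (a * b))
                                                (proj₂ (inverse (v j₀) (v≢0 j₀))) (proj₂ (inverse V₀ (v≢0 _))) ⟨
          w * ((v j₀ * v₀⁻¹) * (V₀ * V₀⁻¹)) ≡⟨ solve 5 (λ w a b c d →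
            w :* ((a :* b) :* (c :* d)) := (w :* a :* d) :* (c :* b)) refl w (v j₀) v₀⁻¹ V₀ V₀⁻¹ ⟩
          α * β                            ∎
        scaleσ : ∀ i → α * u i ≡ u σ⟨ i ⟩
        scaleσ i = begin
          α * u i                        ≡⟨ solve 4 (λ w a d x →
            (w :* a :* d) :* x := (w :* (x :* a)) :* d) refl w (v j₀) V₀⁻¹ (u i) ⟩
          (w * (u i * v j₀)) * V₀⁻¹      ≡⟨ cong (_* V₀⁻¹) (eq i j₀) ⟩
          (u σ⟨ i ⟩ * V₀) * V₀⁻¹         ≡⟨ *-assoc _ _ _ ⟩
          u σ⟨ i ⟩ * (V₀ * V₀⁻¹)         ≡⟨ cong (u σ⟨ i ⟩ *_) (proj₂ (inverse V₀ (v≢0 _))) ⟩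
          u σ⟨ i ⟩ * 1#                  ≡⟨ *-identityʳ _ ⟩
          u σ⟨ i ⟩                       ∎
        scaleτ : ∀ j → β * v j ≡ v τ⟨ j ⟩
        scaleτ j = *-cancelˡ (u≢0 σ⟨ i₀ ⟩) (begin
          u σ⟨ i₀ ⟩ * (β * v j)          ≡⟨ cong (_* (β * v j)) (scaleσ i₀) ⟨
          (α * u i₀) * (β * v j)         ≡⟨ interchange α (u i₀) β (v j) ⟩
          (α * β) * (u i₀ * v j)         ≡⟨ cong (_* (u i₀ * v j)) w≡αβ ⟨
          w * (u i₀ * v j)               ≡⟨ eq i₀ j ⟩
          u σ⟨ i₀ ⟩ * v τ⟨ j ⟩           ∎)

      -- The s t distinct powers of `η` are multipliers and exhaust the roots of x^(st) = 1, among
      -- which every multiplier lies.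
      multiplierGroupOrder : MultiplierGroupOrder F A (s ℕ.* t)
      multiplierGroupOrder =
        tabulate powers ,
        Unique.tabulate⁺ (powers-injective-Fin η-order) ,
        (λ w w∈ → let (e , w≡) = ∈-tabulate⁻ w∈
                  in subst (IsMultiplier F A) (sym w≡) (powers-multiply (toℕ e))) ,
        (λ w mult → let (e , w≡) = roots-of-unity-exhausted (positive η-order) powers
                          (powers-injective-Fin η-order) powers-unit w (multiplier-unit mult)
                    in subst (_∈ tabulate powers) w≡ (∈-tabulate⁺ e)) ,
        length-tabulate powers
        where
        powers : Fin (s ℕ.* t) → Fin q
        powers e = η ^ toℕ e
        powers-unit : ∀ e → powers e ^ (s ℕ.* t) ≡ 1#
        powers-unit e = trans (^-swap η (toℕ e) (s ℕ.* t))
          (trans (cong (_^ toℕ e) (order-unit η-order)) (1^ (toℕ e)))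
        multiplier-unit : ∀ {w} → IsMultiplier F A w → w ^ (s ℕ.* t) ≡ 1#
        multiplier-unit (_   , inj₁ (σ , τ , eq)) = straight-multiplier σ τ eq
        multiplier-unit (w≢0 , inj₂ (σ , τ , eq)) = contradiction eq (no-transposed-multiplier w≢0 σ τ)

  -- Choice of the generators inside the cyclic group of nonzero elements.

  rank-one-heffter : ∀ k s l t → 0 < k → 0 < l → 1 < s → 1 < t →
    Coprime s t → Coprime s 2 → Coprime t 2 → q ≡ suc (2 ℕ.* (k ℕ.* s) ℕ.* (l ℕ.* t)) →
    ∀ m₀ n₀ e f → k ℕ.* s ≡ m₀ ℕ.* 2 ℕ.^ e → l ℕ.* t ≡ n₀ ℕ.* 2 ℕ.^ f →
    m₀ ∣ s ℕ.* t → n₀ ∣ s ℕ.* t →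
    Σ (Matrix F (k ℕ.* s) (l ℕ.* t)) λ A →
      IsHeffter F A × IsRankOne F A × MultiplierGroupOrder F A (s ℕ.* t)
  rank-one-heffter k s l t 0<k 0<l 1<s 1<t co-st co-s2 co-t2 q≡ m₀ n₀ e f m≡ n≡ m₀∣st n₀∣st
    with g , g-order , unit-exponent ← primitive-element q≡ =
    A , isHeffter , isRankOne , multiplierGroupOrder m₀ n₀ e f m≡ n≡ m₀∣st n₀∣st
    where
    ω-exponent : ∀ k s l t → 2 ℕ.* (k ℕ.* s) ℕ.* (l ℕ.* t) ≡ 2 ℕ.* k ℕ.* (l ℕ.* t) ℕ.* s
    ω-exponent = solve-∀
    ζ-exponent : ∀ k s l t → 2 ℕ.* (k ℕ.* s) ℕ.* (l ℕ.* t) ≡ 2 ℕ.* (s ℕ.* t) ℕ.* (l ℕ.* k)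
    ζ-exponent = solve-∀
    -- As `g` has order q - 1 = 2(ks)(lt), the exponents (q - 1)/s and (q - 1)/t give `ω` and `θ`,
    -- and 2st = (q - 1)/(lk) gives `ζ`.
    open Construction k s l t 0<k 0<l 1<s 1<t co-st co-s2 co-t2
      g (g ^ (2 ℕ.* k ℕ.* (l ℕ.* t))) (g ^ (2 ℕ.* (k ℕ.* s) ℕ.* l)) unit-exponent (has-order-≢0 g-order)
      (order-^ (2 ℕ.* k ℕ.* (l ℕ.* t)) (subst (HasOrder g) (ω-exponent k s l t) g-order))
      (order-^ (2 ℕ.* (k ℕ.* s) ℕ.* l) (subst (HasOrder g) (sym (ℕ.*-assoc (2 ℕ.* (k ℕ.* s)) l t)) g-order))
      (order-^ (2 ℕ.* (s ℕ.* t)) (subst (HasOrder g) (ζ-exponent k s l t) g-order))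

-- Reduction of the hypotheses to a split of the odd parts.

open import Data.Nat using (_*_)
open import Data.Nat.Primality using (Prime)
open import Data.Nat.LCM using (lcm)

theorem3 : (m n : ℕ) → 3 ≤ m → 3 ≤ n →
    (q : ℕ) → q ≡ suc (2 * m * n) → IsPrimePower q →
    (∃[ p ] ∃[ p′ ] (Prime p × Prime p′ × Odd p × Odd p′ × p ≢ p′ × p ∣ m × p′ ∣ n)) →
    (mo no : ℕ) → IsOddPart m mo → IsOddPart n no →
    ¬ (mo * rad mo ∣ no) → ¬ (no * rad no ∣ mo) →
    (F : FiniteField q) →
    ∃[ A ] (IsHeffter F {m} {n} A × IsRankOne F A
            × MultiplierGroupOrder F A (lcm mo no))
theorem3 m n 3≤m 3≤n q q≡ _ (p , p′ , pp , pp′ , odd-p , odd-p′ , p≢p′ , p∣m , p′∣n)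
  m₀ n₀ m₀-part@(odd-m₀ , m₀∣m , _) n₀-part@(odd-n₀ , n₀∣n , _) m₀∤ n₀∤ F
  with e , m≡ ← odd-part-cofactor {o = m₀} (ℕ.≤-trans z<s 3≤m) m₀-part
     | f , n≡ ← odd-part-cofactor {o = n₀} (ℕ.≤-trans z<s 3≤n) n₀-part
  -- The odd parts are split rather than `m` and `n`: this keeps `s` and `t` coprime to 2 and makes
  -- `s * t` equal to the lcm of the odd parts.
  with s , t , sp , 1<s , 1<t ← nontrivial-coprime-split
         (divisor-positive m₀∣m (ℕ.≤-trans z<s 3≤m)) (divisor-positive n₀∣n (ℕ.≤-trans z<s 3≤n))
         pp pp′ p≢p′ (odd-divisor e odd-p (subst (p ∣_) m≡ p∣m)) (odd-divisor f odd-p′ (subst (p′ ∣_) n≡ p′∣n))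
         m₀∤ n₀∤
  with divides k refl ← ∣-trans (CoprimeSplit.s∣m sp) m₀∣m
     | divides l refl ← ∣-trans (CoprimeSplit.t∣n sp) n₀∣n =
  subst (λ c → ∃[ A ] (IsHeffter F A × IsRankOne F A × MultiplierGroupOrder F A c)) (split-lcm sp)
    (RankOneHeffter.rank-one-heffter F k s l t
      (divisor-positive (m∣m*n s) (ℕ.≤-trans z<s 3≤m)) (divisor-positive (m∣m*n t) (ℕ.≤-trans z<s 3≤n))
      1<s 1<t coprime
      (coprime-∣ s∣m ∣-refl (odd⇒coprime-2 {m₀} odd-m₀)) (coprime-∣ t∣n ∣-refl (odd⇒coprime-2 {n₀} odd-n₀))
      q≡ m₀ n₀ e f m≡ n≡ m∣s*t n∣s*t)
  where open CoprimeSplit sp
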